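{- Let $G$ be a $P_7$-free graph and let $\Omega$ be a potential maximal clique in $G$. Then there exists a set $\Omega' \subseteq V(G)$ with $|\Omega'| \leq 68$ such that $\Omega \subseteq N_G[\Omega']$.
   Context: All graphs are finite and simple. $P_t$ denotes the path on $t$ vertices; a graph is $P_t$-free if it has no induced subgraph isomorphic to $P_t$. For $X\subseteq V(G)$, $N_G(X)$ is the set of vertices outside $X$ adjacent to some vertex of $X$, and $N_G[X] = X \cup N_G(X)$. A set $F$ of non-edges of $G$ is a chordal completion if the graph $G+F = (V(G), E(G)\cup F)$ is chordal (has no induced cycle on at least four vertices). A set $\Omega \subseteq V(G)$ is a potential maximal clique if there is an inclusion-wise minimal chordal completion $F$ of $G$ such that $\Omega$ is a maximal clique of $G+F$. Equivalently, $\Omega$ is a potential maximal clique iff (1) no connected component $D$ of $G-\Omega$ satisfies $N_G(D)=\Omega$, and (2) for every pair of non-adjacent vertices $u,v\in\Omega$ there is a connected component $D$ of $G-\Omega$ with $\{u,v\}\subseteq N_G(D)$. -}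

module Defs where

open import Data.Nat using (ℕ; suc; _≤_; _<_)
open import Data.Fin using (Fin; toℕ)
open import Data.Fin.Subset using (Subset; _∈_; _∉_; _⊆_; ∣_∣)
open import Data.Bool using (Bool; true; false; _∨_)
open import Data.Product using (Σ; ∃; ∃-syntax; _×_; _,_)
open import Data.Sum using (_⊎_)
open import Relation.Nullary using (¬_)
open import Relation.Binary.PropositionalEquality using (_≡_; _≢_)
open import Function.Definitions using (Injective)
open import Function.Bundles using (_⇔_)

Adj : ℕ → Set
Adj n = Fin n → Fin n → Bool

record Graph (n : ℕ) : Set where
  field
    adj     : Adj n
    sym     : ∀ u v → adj u v ≡ adj v u
    irrefl  : ∀ v → adj v v ≡ false
open Graph public

PathEdge : {t : ℕ} → Fin t → Fin t → Set
PathEdge i j = (suc (toℕ i) ≡ toℕ j) ⊎ (suc (toℕ j) ≡ toℕ i)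

CycleEdge : {k : ℕ} → Fin k → Fin k → Set
CycleEdge {k} i j =
  PathEdge i j ⊎ ((suc (toℕ i) ≡ k × toℕ j ≡ 0) ⊎ (suc (toℕ j) ≡ k × toℕ i ≡ 0))

InducedCopy : {n t : ℕ} → Adj n → (Fin t → Fin t → Set) → Set
InducedCopy {n} {t} A R =
  Σ (Fin t → Fin n) λ f →
    Injective _≡_ _≡_ f × (∀ i j → i ≢ j → (A (f i) (f j) ≡ true ⇔ R i j))

PFree : {n : ℕ} → ℕ → Graph n → Set
PFree t G = ¬ InducedCopy {t = t} (adj G) PathEdge

Chordal : {n : ℕ} → Adj n → Set
Chordal A = ∀ k → 4 ≤ k → ¬ InducedCopy {t = k} A CycleEdge

IsNonEdgeSet : {n : ℕ} → Graph n → Adj n → Set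
IsNonEdgeSet G F =
  (∀ u v → F u v ≡ F v u) × (∀ u v → F u v ≡ true → adj G u v ≡ false × u ≢ v)

_+E_ : {n : ℕ} → Graph n → Adj n → Adj n
(G +E F) u v = adj G u v ∨ F u v

ChordalCompletion : {n : ℕ} → Graph n → Adj n → Set
ChordalCompletion G F = IsNonEdgeSet G F × Chordal (G +E F)

_⊆E_ : {n : ℕ} → Adj n → Adj n → Set
F' ⊆E F = ∀ u v → F' u v ≡ true → F u v ≡ true

MinimalChordalCompletion : {n : ℕ} → Graph n → Adj n → Set
MinimalChordalCompletion G F =
  ChordalCompletion G F ×
  (∀ F' → ChordalCompletion G F' → F' ⊆E F → F ⊆E F')

IsClique : {n : ℕ} → Adj n → Subset n → Set
IsClique A Ω = ∀ u v → u ∈ Ω → v ∈ Ω → u ≢ v → A u v ≡ true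

IsMaximalClique : {n : ℕ} → Adj n → Subset n → Set
IsMaximalClique A Ω =
  IsClique A Ω × (∀ w → w ∉ Ω → ¬ (∀ u → u ∈ Ω → A u w ≡ true))

PotentialMaximalClique : {n : ℕ} → Graph n → Subset n → Set
PotentialMaximalClique G Ω =
  ∃[ F ] (MinimalChordalCompletion G F × IsMaximalClique (G +E F) Ω)

InClosedNbhd : {n : ℕ} → Graph n → Subset n → Fin n → Set
InClosedNbhd G X v = v ∈ X ⊎ ∃[ u ] (u ∈ X × adj G u v ≡ true)

{-# OPTIONS --safe #-}

-- Let A, B be connected anticomplete sets and S a set of vertices with neighbours in both.  Outside
-- the neighbourhoods of four vertices, each s ∈ S starts an induced P4 into A or has N(s) ∩ A complete
-- to the rest of A, and likewise for B; it cannot start a P4 into both.  Among the vertices starting a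
-- P4 v b₁ b₂ b₃ into B, take v with N(v) ∩ A minimal and a ∈ N(v) ∩ A: any other u is adjacent to one
-- of v, a, b₁, b₂, b₃, else u a′ a v b₁ b₂ b₃ is a P7 for some a′ ∈ A.  If A and B both behave like
-- cliques, remove the neighbourhoods of at most two pairs of vertices incomparable in both A and B, of
-- their private neighbours, and of two more vertices; then any two of the remaining vertices are
-- comparable in A or in B, and a single one lies below each other in one of the two orders.
--
-- For a potential maximal clique Ω, choose a non-adjacent pair u, v ∈ Ω with an inclusion-minimal set
-- of components of G − Ω seen by both.  A vertex of Ω far from u and v either sees a component at u
-- but not v and one at v but not u, which makes a set S as above, or, by minimality, sees every
-- component seen by both u and v; the neighbourhood of one component is again such a set S.
module Submission where

open import Defs
open import Data.Nat using (ℕ; zero; suc; _+_; _≤_; _<_; z≤n; s≤s; _≤?_)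
open import Data.Nat.Properties using (suc-injective; ≤-refl; ≤-reflexive; ≤-trans; ≤-pred; ≤∧≢⇒<; <-trans)
open import Data.Nat.Properties using (<-irrefl; <⇒≢; <⇒≱; n≮0; n≤1+n; m≤m+n; +-mono-≤; +-monoʳ-≤; +-suc)
open import Data.Fin using (Fin; zero; suc; toℕ; fromℕ; inject₁)
open import Data.Fin.Induction using (>-weakInduction)
open import Data.Fin.Properties using (toℕ-fromℕ; toℕ-inject₁; toℕ<n; toℕ-injective; fromℕ≢inject₁; inject₁-injective)
open import Data.Fin.Properties using (all?) renaming (_≟_ to _≟ᶠ_; any? to anyᶠ?)
open import Data.Fin.Subset using (Subset; _∈_; ∣_∣; _∉_; _⊂_; _⊃_; _∪_; ⋃; ⁅_⁆)
open import Data.Fin.Subset.Induction using (⊃-wellFounded; Acc; acc)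
open import Data.Fin.Subset.Properties using (_∈?_; x∈⁅x⁆; x∈⁅y⁆⇒x≡y; x∈p∪q⁺; ∣⊥∣≡0; ∣⁅x⁆∣≡1; anySubset?)
open import Data.Vec using (tabulate) renaming ([] to []ᵛ; _∷_ to _∷ᵛ_)
open import Data.Vec.Properties using (lookup∘tabulate; []=⇒lookup; lookup⇒[]=)
open import Data.Bool using (true; false; _∧_; _∨_)
open import Data.Bool.Properties using (∨-zeroʳ) renaming (_≟_ to _≟ᵇ_)
open import Data.Empty using (⊥)
open import Data.List using (List; []; _∷_; length; lookup; take; _++_; allFin; cartesianProduct) renaming (map to mapᴸ)
open import Data.List.Properties using (length-++)
open import Data.List.Membership.Propositional using (find) renaming (_∈_ to _∈ˡ_)
open import Data.List.Membership.Propositional.Properties using (∈-allFin; ∈-cartesianProduct⁺; ∈-lookup)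
open import Data.List.Relation.Unary.All using (All; []; _∷_) renaming (map to mapAll; lookup to lookupAll)
open import Data.List.Relation.Unary.All.Properties using (¬Any⇒All¬; take⁺)
open import Data.List.Relation.Unary.Any using (Any; here; there; any?)
open import Data.List.Relation.Unary.Any.Properties using (++⁺ˡ; ++⁺ʳ)
open import Data.Product using (∃; ∃-syntax; _×_; _,_; proj₁; proj₂)
open import Data.Sum using (_⊎_; inj₁; inj₂; [_,_])
open import Data.Unit using (⊤; tt)
open import Function using (_∘_; id; case_of_)
open import Function.Bundles using (_⇔_; mk⇔; Equivalence)
open import Function.Definitions using (Injective)
open import Relation.Binary.Construct.Closure.ReflexiveTransitive using (Star; ε; _◅_; _◅◅_; reverse; gmap)
open import Relation.Binary.PropositionalEquality using (_≡_; _≢_; refl; trans; cong; cong₂; subst) renaming (sym to ≡-sym)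
open import Relation.Nullary using (¬_; Dec; yes; no; does; contradiction; _×-dec_; _⊎-dec_; _→-dec_)
open import Relation.Nullary.Decidable using (decidable-stable; ¬¬-excluded-middle; does-⇔)

-- Classical reasoning on finite sets, and minimal elements of preorders.

-- Decidability of the conclusion allows classical reasoning under ¬ ¬ throughout.
infixl 1 _>>=_
_>>=_ : {X Y : Set} → ¬ ¬ X → (X → ¬ ¬ Y) → ¬ ¬ Y
(m >>= f) k = m λ x → f x k

return : {X : Set} → X → ¬ ¬ X
return x k = k x

em : (X : Set) → ¬ ¬ (Dec X)
em X = ¬¬-excluded-middle

infix 4 _⊑_
_⊑_ : {Y : Set} → (Y → Set) → (Y → Set) → Set
P ⊑ Q = ∀ y → P y → Q y

⊑-trans : {Y : Set} {P Q R : Y → Set} → P ⊑ Q → Q ⊑ R → P ⊑ R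
⊑-trans s t y = t y ∘ s y

Enumeration : Set → Set
Enumeration X = ∃ λ (xs : List X) → ∀ x → x ∈ˡ xs

-- `f` pulls inclusion back to a preorder, so minimality asks that whatever lies below `m` be
-- equivalent to it rather than equal.
Minimal : {X Y : Set} → (X → Y → Set) → (X → Set) → X → Set
Minimal f P m = P m × (∀ w → P w → f w ⊑ f m → f m ⊑ f w)

minimal-in : {X Y : Set} (f : X → Y → Set) (P : X → Set) (xs : List X) →
  ¬ ¬ ((∀ w → w ∈ˡ xs → ¬ P w) ⊎
       ∃ λ m → P m × (∀ w → w ∈ˡ xs → P w → f w ⊑ f m → f m ⊑ f w))
minimal-in f P [] = return (inj₁ λ _ ())
minimal-in f P (x ∷ xs) = do
  r ← minimal-in f P xs
  d ← em (P x)
  case r , d of λ where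
    (inj₁ none , no ¬p) → return (inj₁ λ { _ (here refl) → ¬p ; w (there q) → none w q })
    (inj₁ none , yes p) → return (inj₂ (x , p , λ
      { _ (here refl) _ s → s
      ; w (there q) pw _ → contradiction pw (none w q) }))
    (inj₂ (m , pm , min) , no ¬p) → return (inj₂ (m , pm , λ
      { _ (here refl) p _ → contradiction p ¬p
      ; w (there q) → min w q }))
    (inj₂ (m , pm , min) , yes p) → em (f x ⊑ f m) >>= λ where
      (yes s) → return (inj₂ (x , p , λ
        { _ (here refl) _ s′ → s′
        ; w (there q) pw t → ⊑-trans s (min w q pw (⊑-trans t s)) }))
      (no ¬s) → return (inj₂ (m , pm , λ
        { _ (here refl) _ s → contradiction s ¬s
        ; w (there q) → min w q }))

minimal : {X Y : Set} → Enumeration X → (f : X → Y → Set) (P : X → Set) →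
  ∃ P → ¬ ¬ ∃ (Minimal f P)
minimal (xs , all) f P (x , p) = minimal-in f P xs >>= λ where
  (inj₁ none) → contradiction p (none x (all x))
  (inj₂ (m , pm , min)) → return (m , pm , λ w → min w (all w))

-- A g-minimal y escaping x in both orders would lie in K and strictly f-below x.
bi-ranking : {X Y Z : Set} → Enumeration X → (f : X → Y → Set) (g : X → Z → Set) (P : X → Set) →
  (∀ x y → P x → P y → ¬ ¬ ((f x ⊑ f y ⊎ f y ⊑ f x) ⊎ (g x ⊑ g y ⊎ g y ⊑ g x))) →
  ∃ P → ¬ ¬ ∃ λ m → P m × (∀ w → P w → ¬ ¬ (f m ⊑ f w ⊎ g m ⊑ g w))
bi-ranking {X} enum f g P comparable inhabited = do
  b , pb , b-min ← minimal enum g P inhabited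
  -- `K` is inhabited: whatever is `g`-below the `g`-minimal `b` is also `g`-above it.
  x , (px , kx) , x-min ← minimal enum f K (b , pb , λ y py s → return (inj₂ (b-min y py s)))
  d ← em (∃ (Escapes x))
  case d of λ where
    (no none) → return (x , px , λ w pw k → none (w , pw , k ∘ inj₁ , k ∘ inj₂))
    (yes e) → do
      y , (py , ¬f , ¬g) , y-min ← minimal enum g (Escapes x) e
      c ← comparable x y px py
      case c of λ where
        (inj₁ (inj₁ s)) → contradiction s ¬f
        (inj₂ (inj₁ s)) → contradiction s ¬g
        (inj₂ (inj₂ s)) → λ _ → kx y py s [ ¬f , ¬g ]
        -- `y` is in `K`: if `z` is `g`-below `y`, then either `f x ⊑ f z`, whence `f y ⊑ f z`, or
        -- `z` escapes `x` as well and `y-min` applies; `g x ⊑ g z` would give `g x ⊑ g y`.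
        (inj₁ (inj₂ s)) → contradiction
          (x-min y
            (py , λ z pz gz⊑gy k → k (inj₂ (y-min z
              (pz , (λ t → k (inj₁ (⊑-trans s t))) , (λ t → ¬g (⊑-trans t gz⊑gy))) gz⊑gy)))
            s)
          ¬f
  where
  K : X → Set
  K x = P x × (∀ y → P y → g y ⊑ g x → ¬ ¬ (f x ⊑ f y ⊎ g x ⊑ g y))
  Escapes : X → X → Set
  Escapes x y = P y × ¬ (f x ⊑ f y) × ¬ (g x ⊑ g y)

fins : ∀ n → Enumeration (Fin n)
fins n = allFin n , ∈-allFin

pairs : {X : Set} → Enumeration X → Enumeration (X × X)
pairs (xs , all) = cartesianProduct xs xs , λ { (x , y) → ∈-cartesianProduct⁺ (all x) (all y) }

-- Double-negation shift, constructive over a finite index set; it allows deciding a predicate at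
-- all vertices at once.
¬¬-Π : ∀ {n} {P : Fin n → Set} → (∀ i → ¬ ¬ P i) → ¬ ¬ (∀ i → P i)
¬¬-Π {zero} f = return λ ()
¬¬-Π {suc n} f = do
  p ← f zero
  ps ← ¬¬-Π (f ∘ suc)
  return λ { zero → p ; (suc i) → ps i }

crossing : {X : Set} {R : X → X → Set} (P : X → Set) {x y : X} → Star R x y → P x → ¬ P y →
  ¬ ¬ ∃ λ p → ∃ λ q → R p q × P p × ¬ P q
crossing P ε px ¬py = contradiction px ¬py
crossing P {x} (_◅_ {j = z} s ss) px ¬py = em (P z) >>= λ where
  (yes pz) → crossing P ss pz ¬py
  (no ¬pz) → return (x , z , s , px , ¬pz)

maximal : ∀ {n} (Q : Subset n → Set) → ∃ Q → ¬ ¬ ∃ λ M → Q M × (∀ S → Q S → ¬ M ⊂ S)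
maximal {n} Q (M₀ , q₀) = go M₀ (⊃-wellFounded M₀) q₀
  where
  go : ∀ M → Acc _⊃_ M → Q M → ¬ ¬ ∃ λ M → Q M × (∀ S → Q S → ¬ M ⊂ S)
  go M (acc rs) q = em (∃ λ S → Q S × M ⊂ S) >>= λ where
    (yes (S , qS , M⊂S)) → go S (rs M⊂S) qS
    (no none) → return (M , q , λ S qS M⊂S → none (S , qS , M⊂S))

comprehension : ∀ {n} (P : Fin n → Set) → ¬ ¬ ∃ λ S → ∀ x → (x ∈ S → P x) × (P x → x ∈ S)
comprehension P = do
  P? ← ¬¬-Π (λ x → em (P x))
  let S = tabulate (does ∘ P?)
      ⇒ : ∀ x → x ∈ S → P x
      ⇒ x x∈S = dec⇒ (P? x) (trans (≡-sym (lookup∘tabulate (does ∘ P?) x)) ([]=⇒lookup x∈S))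
      ⇐ : ∀ x → P x → x ∈ S
      ⇐ x px = lookup⇒[]= x S (trans (lookup∘tabulate (does ∘ P?) x) (dec⇐ (P? x) px))
  return (S , λ x → ⇒ x , ⇐ x)
  where
  dec⇒ : {X : Set} (d : Dec X) → does d ≡ true → X
  dec⇒ (yes x) _ = x
  dec⇐ : {X : Set} (d : Dec X) → X → does d ≡ true
  dec⇐ (yes _) _ = refl
  dec⇐ (no ¬x) x = contradiction x ¬x

-- Induced paths, holes and chordal graphs.

cycle-sym : ∀ {k} {i j : Fin k} → CycleEdge i j → CycleEdge j i
cycle-sym (inj₁ (inj₁ e)) = inj₁ (inj₂ e)
cycle-sym (inj₁ (inj₂ e)) = inj₁ (inj₁ e)
cycle-sym (inj₂ (inj₁ e)) = inj₂ (inj₂ e)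
cycle-sym (inj₂ (inj₂ e)) = inj₂ (inj₁ e)

module InducedPaths {n : ℕ} (R : Adj n) (R-sym : ∀ u v → R u v ≡ true → R v u ≡ true)
  (R-irrefl : ∀ v → ¬ R v v ≡ true) where

  Apart : Fin n → Fin n → Set
  Apart x z = x ≢ z × ¬ R x z ≡ true

  -- `Apart` is asked only beyond the successor; distinctness from the successor comes from
  -- irreflexivity.
  Induced : List (Fin n) → Set
  Induced [] = ⊥
  Induced (x ∷ []) = ⊤
  Induced (x ∷ y ∷ zs) = R x y ≡ true × All (Apart x) zs × Induced (y ∷ zs)

  induced-injective : ∀ xs → Induced xs → ∀ i j → lookup xs i ≡ lookup xs j → i ≡ j
  induced-injective (x ∷ zs) _ zero zero _ = refl
  induced-injective (x ∷ y ∷ zs) (e , _ , _) zero (suc zero) refl = contradiction e (R-irrefl x)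
  induced-injective (x ∷ y ∷ zs) (_ , a , _) zero (suc (suc j)) eq = contradiction eq (proj₁ (lookupAll a (∈-lookup j)))
  induced-injective (x ∷ y ∷ zs) (e , _ , _) (suc zero) zero refl = contradiction e (R-irrefl x)
  induced-injective (x ∷ y ∷ zs) (_ , a , _) (suc (suc i)) zero eq = contradiction (≡-sym eq) (proj₁ (lookupAll a (∈-lookup i)))
  induced-injective (x ∷ y ∷ zs) (_ , _ , p) (suc i) (suc j) eq = cong suc (induced-injective (y ∷ zs) p i j eq)
  induced-injective (x ∷ []) _ zero (suc ()) _
  induced-injective (x ∷ []) _ (suc ()) _ _

  suc-PathEdge : ∀ {t} {i j : Fin t} → PathEdge i j → PathEdge (suc i) (suc j)
  suc-PathEdge (inj₁ e) = inj₁ (cong suc e)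
  suc-PathEdge (inj₂ e) = inj₂ (cong suc e)

  induced-edge⇒ : ∀ xs → Induced xs → ∀ i j → R (lookup xs i) (lookup xs j) ≡ true → PathEdge i j
  induced-edge⇒ (x ∷ zs) _ zero zero e = contradiction e (R-irrefl x)
  induced-edge⇒ (x ∷ y ∷ zs) _ zero (suc zero) _ = inj₁ refl
  induced-edge⇒ (x ∷ y ∷ zs) (_ , a , _) zero (suc (suc j)) e = contradiction e (proj₂ (lookupAll a (∈-lookup j)))
  induced-edge⇒ (x ∷ y ∷ zs) _ (suc zero) zero _ = inj₂ refl
  induced-edge⇒ (x ∷ y ∷ zs) (_ , a , _) (suc (suc i)) zero e = contradiction (R-sym _ _ e) (proj₂ (lookupAll a (∈-lookup i)))
  induced-edge⇒ (x ∷ y ∷ zs) (_ , _ , p) (suc i) (suc j) e = suc-PathEdge (induced-edge⇒ (y ∷ zs) p i j e)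

  private
    induced-step : ∀ xs → Induced xs → ∀ i j → suc (toℕ i) ≡ toℕ j → R (lookup xs i) (lookup xs j) ≡ true
    induced-step (x ∷ y ∷ zs) (e , _) zero (suc zero) _ = e
    induced-step (x ∷ y ∷ zs) (_ , _ , p) (suc i) (suc j) eq = induced-step (y ∷ zs) p i j (suc-injective eq)

  induced-edge⇐ : ∀ xs → Induced xs → ∀ i j → PathEdge i j → R (lookup xs i) (lookup xs j) ≡ true
  induced-edge⇐ xs p i j (inj₁ e) = induced-step xs p i j e
  induced-edge⇐ xs p i j (inj₂ e) = R-sym _ _ (induced-step xs p j i e)

  induced-copy : ∀ xs → Induced xs → InducedCopy {t = length xs} R PathEdge
  induced-copy xs p = lookup xs , (λ {i} {j} → induced-injective xs p i j) ,
    λ i j _ → mk⇔ (induced-edge⇒ xs p i j) (induced-edge⇐ xs p i j)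

  end : Fin n → List (Fin n) → Fin n
  end x [] = x
  end x (y ∷ ys) = end y ys

  Within : (Fin n → Set) → Fin n → Fin n → Set
  Within C x y = C x × C y × R x y ≡ true

  -- The shortcut leaves y ∷ zs at the last vertex that equals x or is adjacent to x.
  Shortcut : Fin n → Fin n → List (Fin n) → Set₁
  Shortcut x y zs = ∃ λ zs′ → Induced (x ∷ zs′) × end x zs′ ≡ end y zs ×
    (∀ {C : Fin n → Set} → All C (y ∷ zs) → All C zs′)

  -- The tail is tried first, so when the search returns to `y` without a shortcut, `x` is known to
  -- be apart from all of `zs` and may be joined at `y`.
  attach : ∀ x y zs → Induced (y ∷ zs) → Shortcut x y zs ⊎ All (Apart x) (y ∷ zs)
  attach x y zs p with tail zs p
    where
    tail : ∀ zs → Induced (y ∷ zs) → Shortcut x y zs ⊎ All (Apart x) zs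
    tail [] _ = inj₂ []
    tail (z ∷ zs) (_ , _ , p) with attach x z zs p
    ... | inj₁ (zs′ , p′ , e , sub) = inj₁ (zs′ , p′ , e , λ { (_ ∷ cs) → sub cs })
    ... | inj₂ apart = inj₂ apart
  ... | inj₁ s = inj₁ s
  ... | inj₂ apart with x ≟ᶠ y | R x y ≟ᵇ true
  ... | yes refl | _ = inj₁ (zs , p , refl , λ { (_ ∷ cs) → cs })
  ... | no _ | yes e = inj₁ (y ∷ zs , (e , apart , p) , refl , id)
  ... | no x≢y | no ¬e = inj₂ ((x≢y , ¬e) ∷ apart)

  shortcut : ∀ x y zs → Induced (y ∷ zs) → R x y ≡ true → Shortcut x y zs
  shortcut x y zs p e with attach x y zs p
  ... | inj₁ s = s
  ... | inj₂ ((_ , ¬e) ∷ _) = contradiction e ¬e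

  -- The path is built from the end of the walk: each vertex is put before an induced path on the
  -- rest, and `shortcut` drops what it bypasses.
  induced-path : ∀ {C x y} → C x → Star (Within C) x y →
    ∃ λ zs → Induced (x ∷ zs) × end x zs ≡ y × All C (x ∷ zs)
  induced-path cx ε = [] , tt , refl , cx ∷ []
  induced-path {x = x} cx (_◅_ {j = z} (_ , cz , e) ss) with induced-path cz ss
  ... | zs , p , end≡ , all with shortcut x z zs p e
  ... | zs′ , p′ , end≡′ , sub = zs′ , p′ , trans end≡′ end≡ , cx ∷ sub all

  induced-take : ∀ m x zs → Induced (x ∷ zs) → Induced (x ∷ take m zs)
  induced-take zero x zs p = tt
  induced-take (suc m) x [] p = tt
  induced-take (suc m) x (y ∷ zs) (e , a , p) = e , take⁺ m a , induced-take m y zs p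

  SeesLast : Fin n → List (Fin n) → Set
  SeesLast x [] = ⊥
  SeesLast x (z ∷ []) = x ≢ z × R x z ≡ true
  SeesLast x (z ∷ z′ ∷ zs) = Apart x z × SeesLast x (z′ ∷ zs)

  sees-last-distinct : ∀ {x} zs → SeesLast x zs → ∀ j → x ≢ lookup zs j
  sees-last-distinct (z ∷ []) (ne , _) zero = ne
  sees-last-distinct (z ∷ z′ ∷ zs) ((ne , _) , _) zero = ne
  sees-last-distinct (z ∷ z′ ∷ zs) (_ , s) (suc j) = sees-last-distinct (z′ ∷ zs) s j

  sees-last⇒ : ∀ {x} zs → SeesLast x zs → ∀ j → R x (lookup zs j) ≡ true → suc (toℕ j) ≡ length zs
  sees-last⇒ (z ∷ []) _ zero _ = refl
  sees-last⇒ (z ∷ z′ ∷ zs) ((_ , ¬e) , _) zero e = contradiction e ¬e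
  sees-last⇒ (z ∷ z′ ∷ zs) (_ , s) (suc j) e = cong suc (sees-last⇒ (z′ ∷ zs) s j e)

  sees-last⇐ : ∀ {x} zs → SeesLast x zs → ∀ j → suc (toℕ j) ≡ length zs → R x (lookup zs j) ≡ true
  sees-last⇐ (z ∷ []) (_ , e) zero _ = e
  sees-last⇐ (z ∷ z′ ∷ zs) (_ , s) (suc j) eq = sees-last⇐ (z′ ∷ zs) s j (suc-injective eq)

  first-neighbour : ∀ {x} z zs → All (x ≢_) (z ∷ zs) → R x (end z zs) ≡ true →
    ∃ λ m → SeesLast x (z ∷ take m zs)
  first-neighbour {x} z zs (ne ∷ nes) e with R x z ≟ᵇ true
  ... | yes xz = 0 , ne , xz
  first-neighbour z [] (ne ∷ nes) e | no ¬xz = contradiction e ¬xz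
  first-neighbour z (z′ ∷ zs) (ne ∷ nes) e | no ¬xz with first-neighbour z′ zs nes e
  ... | m , s = suc m , (ne , ¬xz) , s

  hole-copy : ∀ x y zs → Induced (y ∷ zs) → R x y ≡ true → SeesLast x zs →
    InducedCopy {t = length (x ∷ y ∷ zs)} R CycleEdge
  hole-copy x y zs p xy s = f , (λ {i} {j} → inj i j) , λ i j i≢j → mk⇔ (⇒ i j i≢j) (⇐ i j i≢j)
    where
    f : Fin (length (x ∷ y ∷ zs)) → Fin n
    f = lookup (x ∷ y ∷ zs)
    distinct : ∀ j → x ≢ lookup (y ∷ zs) j
    distinct zero refl = R-irrefl x xy
    distinct (suc j) = sees-last-distinct zs s j
    inj : ∀ i j → f i ≡ f j → i ≡ j
    inj zero zero _ = refl
    inj zero (suc j) eq = contradiction eq (distinct j)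
    inj (suc i) zero eq = contradiction (≡-sym eq) (distinct i)
    inj (suc i) (suc j) eq = cong suc (induced-injective (y ∷ zs) p i j eq)
    ⇒₀ : ∀ j → R x (f (suc j)) ≡ true → CycleEdge zero (suc j)
    ⇒₀ zero _ = inj₁ (inj₁ refl)
    ⇒₀ (suc j) e = inj₂ (inj₂ (cong (2 +_) (sees-last⇒ zs s j e) , refl))
    ⇐₀ : ∀ j → CycleEdge zero (suc j) → R x (f (suc j)) ≡ true
    ⇐₀ zero _ = xy
    ⇐₀ (suc j) (inj₁ (inj₁ ()))
    ⇐₀ (suc j) (inj₁ (inj₂ ()))
    ⇐₀ (suc j) (inj₂ (inj₂ (eq , _))) = sees-last⇐ zs s j (suc-injective (suc-injective eq))
    ⇒ : ∀ i j → i ≢ j → R (f i) (f j) ≡ true → CycleEdge i j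
    ⇒ zero zero ne _ = contradiction refl ne
    ⇒ zero (suc j) _ e = ⇒₀ j e
    ⇒ (suc i) zero _ e = cycle-sym (⇒₀ i (R-sym _ _ e))
    ⇒ (suc i) (suc j) _ e = inj₁ (suc-PathEdge (induced-edge⇒ (y ∷ zs) p i j e))
    ⇐ : ∀ i j → i ≢ j → CycleEdge i j → R (f i) (f j) ≡ true
    ⇐ zero zero ne _ = contradiction refl ne
    ⇐ zero (suc j) _ c = ⇐₀ j c
    ⇐ (suc i) zero _ c = R-sym _ _ (⇐₀ i (cycle-sym c))
    ⇐ (suc i) (suc j) _ (inj₁ (inj₁ eq)) = induced-edge⇐ (y ∷ zs) p i j (inj₁ (suc-injective eq))
    ⇐ (suc i) (suc j) _ (inj₁ (inj₂ eq)) = induced-edge⇐ (y ∷ zs) p i j (inj₂ (suc-injective eq))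
    ⇐ (suc i) (suc j) _ (inj₂ (inj₁ (_ , ())))
    ⇐ (suc i) (suc j) _ (inj₂ (inj₂ (_ , ())))

  module _ (chordal : Chordal R) where

    -- If `x` missed `d`, the path from `k` to the first neighbour of `x` beyond `d` would close up
    -- through `x` to a hole; `x`, `k`, `d` and that neighbour make its length at least four.
    chordal-fan : ∀ {x k d} ds → Induced (k ∷ d ∷ ds) → All (x ≢_) (d ∷ ds) →
      R x k ≡ true → R x (end d ds) ≡ true → R x d ≡ true
    chordal-fan {x} {k} {d} ds p nes xk xe with R x d ≟ᵇ true
    ... | yes xd = xd
    chordal-fan [] p nes xk xe | no ¬xd = xe
    chordal-fan {x} {k} {d} (z ∷ zs) p (ne ∷ nes) xk xe | no ¬xd with first-neighbour z zs nes xe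
    ... | m , s = contradiction
      (hole-copy x k (d ∷ z ∷ take m zs) (induced-take (suc (suc m)) k (d ∷ z ∷ zs) p) xk ((ne , ¬xd) , s))
      (chordal _ (s≤s (s≤s (s≤s (s≤s z≤n)))))

    -- Take `c` in `C` missing an inclusion-minimal set of vertices of `K`. If it misses `k`, follow
    -- an induced path from `k` through `C` to `c`: by `chordal-fan` its first vertex `d` after `k`
    -- sees every neighbour of `c` in `K`, and it sees `k` as well.
    complete-vertex : ∀ {K C : Fin n → Set} → (∀ {k} → K k → ¬ C k) →
      (∀ {k k′} → K k → K k′ → k ≢ k′ → R k k′ ≡ true) →
      (∀ {x y} → C x → C y → Star (Within C) x y) →
      (∀ {k} → K k → ∃ λ c → C c × R k c ≡ true) →
      ∃ C → ¬ ¬ ∃ λ c → C c × (∀ k → K k → R k c ≡ true)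
    complete-vertex {K} {C} disjoint clique connected sees eC = do
      c , cc , c-min ← minimal (fins n) (λ c k → K k × ¬ R k c ≡ true) C eC
      return (c , cc , λ k kk → decidable-stable (R k c ≟ᵇ true) λ ¬kc →
        let c₀ , cc₀ , kc₀ = sees kk
            zs , p , end≡ , all = induced-path cc₀ (connected cc₀ cc)
        in case shortcut k c₀ zs p kc₀ of λ where
          ([] , _ , end≡′ , _) → disjoint kk (subst C (≡-sym (trans end≡′ end≡)) cc)
          (d ∷ ds , p′ , end≡′ , sub) → case sub all of λ where
            (cd ∷ cds) → proj₂ (c-min d cd
              (λ k′ (kk′ , ¬k′d) → kk′ , λ k′c → ¬k′d
                (chordal-fan ds p′
                  (mapAll (λ { cz refl → disjoint kk′ cz }) (cd ∷ cds))
                  (clique kk′ kk λ { refl → ¬kc k′c })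
                  (subst (λ z → R k′ z ≡ true) (≡-sym (trans end≡′ end≡)) k′c)))
              k (kk , ¬kc)) (proj₁ p′))

-- Neighbourhoods, covers and modules.

module Neighbourhoods {n : ℕ} (G : Graph n) where

  V : Set
  V = Fin n

  infix 4 _~_
  _~_ : V → V → Set
  u ~ v = adj G u v ≡ true

  ~-sym : ∀ {u v} → u ~ v → v ~ u
  ~-sym {u} {v} e = trans (Defs.sym G v u) e

  ≁-sym : ∀ {u v} → ¬ u ~ v → ¬ v ~ u
  ≁-sym k e = k (~-sym e)

  ~-irrefl : ∀ v → ¬ v ~ v
  ~-irrefl v e with trans (≡-sym e) (irrefl G v)
  ... | ()

  ~-stable : ∀ {u v} → ¬ ¬ u ~ v → u ~ v
  ~-stable {u} {v} = decidable-stable (adj G u v ≟ᵇ true)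

  -- Open neighbourhoods suffice: the covers below also dominate their own members.
  Near : List V → V → Set
  Near xs v = Any (_~ v) xs

  Far : List V → V → Set
  Far xs v = All (λ x → ¬ x ~ v) xs

  near? : ∀ xs v → Dec (Near xs v)
  near? xs v = any? (λ x → adj G x v ≟ᵇ true) xs

  Cov : ℕ → (V → Set) → Set
  Cov k P = ∃ λ xs → length xs ≤ k × (∀ v → P v → Near xs v)

  cov-none : ∀ {k P} → (∀ v → ¬ P v) → Cov k P
  cov-none none = [] , z≤n , λ v p → contradiction p (none v)

  cov-≤ : ∀ {k l P} → k ≤ l → Cov k P → Cov l P
  cov-≤ k≤l (xs , le , c) = xs , ≤-trans le k≤l , c

  cov-by : ∀ {P} xs → (∀ v → P v → ¬ Far xs v) → Cov (length xs) P
  cov-by xs c = xs , ≤-refl , λ v p → decidable-stable (near? xs v) (c v p ∘ ¬Any⇒All¬ xs)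

  cov-rest : ∀ {k P} xs → Cov k (λ v → P v × Far xs v) → Cov (length xs + k) P
  cov-rest {k} {P} xs (ys , le , c) =
    xs ++ ys , subst (_≤ length xs + k) (≡-sym (length-++ xs)) (+-monoʳ-≤ (length xs) le) , near
    where
    near : ∀ v → P v → Near (xs ++ ys) v
    near v p with near? xs v
    ... | yes q = ++⁺ˡ q
    ... | no ¬q = ++⁺ʳ xs (c v (p , ¬Any⇒All¬ xs ¬q))

  cov-⊎ : ∀ {k l P Q R} → (∀ v → R v → ¬ ¬ (P v ⊎ Q v)) → Cov k P → Cov l Q → Cov (k + l) R
  cov-⊎ {k} {l} {P} {Q} {R} cases (xs , le , c) (ys , le′ , c′) =
    xs ++ ys , subst (_≤ k + l) (≡-sym (length-++ xs)) (+-mono-≤ le le′) , λ v r →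
      decidable-stable (near? (xs ++ ys) v) λ ¬near →
        cases v r [ (λ p → ¬near (++⁺ˡ (c v p))) , (λ q → ¬near (++⁺ʳ xs (c′ v q))) ]

  cov-weaken : ∀ {k P Q} → (∀ v → Q v → ¬ ¬ P v) → Cov k P → Cov k Q
  cov-weaken Q⇒P (xs , le , c) = xs , le , λ v q → decidable-stable (near? xs v) λ ¬near → Q⇒P v q (¬near ∘ c v)

  Nb : (V → Set) → V → V → Set
  Nb A u a = A a × u ~ a

  Priv : (V → Set) → V → V → Set
  Priv A u v = ∃ λ a → A a × u ~ a × ¬ v ~ a

  ⋢⇒Priv : ∀ {A u v} → ¬ (Nb A u ⊑ Nb A v) → ¬ ¬ Priv A u v
  ⋢⇒Priv ¬s k = ¬s λ y (ay , u~y) → ay , ~-stable λ v≁y → k (y , ay , u~y , v≁y)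

  Anticomplete : (V → Set) → (V → Set) → Set
  Anticomplete A B = ∀ {a b} → A a → B b → ¬ a ~ b

  anti-sym : ∀ {A B} → Anticomplete A B → Anticomplete B A
  anti-sym anti b a = ≁-sym (anti a b)

  Good : (V → Set) → V → Set
  Good A u = ∀ {a b} → A a → A b → u ~ a → ¬ u ~ b → a ~ b

  -- An induced P4 starting at `u`; its vertices are distinct because the listed adjacencies tell
  -- them apart.
  Fork : (V → Set) → V → Set
  Fork A u = ∃ λ x → ∃ λ y → ∃ λ z → A x × A y × A z ×
    u ~ x × x ~ y × y ~ z × ¬ u ~ y × ¬ u ~ z × ¬ x ~ z

  Step : (V → Set) → V → V → Set
  Step A x y = A x × A y × x ~ y

  Joined : (V → Set) → V → V → Set
  Joined A = Star (Step A)

  joined-sym : ∀ {A x y} → Joined A x y → Joined A y x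
  joined-sym = reverse λ (ax , ay , xy) → ay , ax , ~-sym xy

  joined-end : ∀ {A x y} → A x → Joined A x y → A y
  joined-end ax ε = ax
  joined-end ax ((_ , az , _) ◅ ss) = joined-end az ss

  Connected : (V → Set) → Set
  Connected A = ∀ {x y} → A x → A y → Joined A x y

  -- Modules in the sense of modular decomposition, tested against the vertices of `A` only.
  Module : (V → Set) → (V → Set) → Set
  Module A M = ∀ {x m m′} → A x → ¬ M x → M m → M m′ → x ~ m → x ~ m′

  union-module : ∀ {A M N p} → Module A M → Module A N → M p → N p → Module A (λ x → M x ⊎ N x)
  union-module {M = M} {N} {p} modM modN mp np {x} {m} {m′} ax ¬x m∈ m′∈ xm = from-p m′∈ (to-p m∈ xm)
    where
    to-p : ∀ {m} → M m ⊎ N m → x ~ m → x ~ p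
    to-p (inj₁ k) = modM ax (¬x ∘ inj₁) k mp
    to-p (inj₂ k) = modN ax (¬x ∘ inj₂) k np
    from-p : ∀ {m} → M m ⊎ N m → x ~ p → x ~ m
    from-p (inj₁ k) = modM ax (¬x ∘ inj₁) mp k
    from-p (inj₂ k) = modN ax (¬x ∘ inj₂) np k

  -- If `x` sees some but not all of the component, it sees exactly one end of some edge `s t`
  -- inside it. As `x` is outside the component, `u` sees `x`, and u x s t is a fork.
  nonneighbour-component-module : ∀ {A u p} → ¬ Fork A u → A p → ¬ u ~ p →
    Module A (Joined (λ y → A y × ¬ u ~ y) p)
  nonneighbour-component-module {A} {u} {p} no-fork ap up {x} ax ¬cx cm cm′ xm =
    ~-stable λ xm′ →
    crossing (x ~_) (joined-sym cm ◅◅ cm′) xm xm′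
      λ (s , t , ((as , us) , (at , ut) , st) , xs , xt) →
        no-fork (x , s , t , ax , as , at , ux , xs , st , us , ut , xt)
    where
    ux : u ~ x
    ux = ~-stable λ k → ¬cx (cm ◅◅ (joined-end (ap , up) cm , (ax , k) , ~-sym xm) ◅ ε)

  -- The edge leaves a maximal proper module M of A.  If u misses both ends, their component C in
  -- A ∖ N(u) is a proper module too, and M ∪ C = A by maximality.
  dominating-edge : ∀ {A} → Connected A → ∃ A → ¬ ¬ ∃ λ p → ∃ λ q →
    ∀ u → ∃ (Nb A u) → Far (p ∷ q ∷ []) u → ¬ Fork A u → Good A u
  dominating-edge {A} conn (x , ax) = do
    d ← em (∃ λ y → A y × y ≢ x)
    case d of λ where
      (no none) → return (x , x , λ { u (a , aa , ua) (xu ∷ _) _ → case a ≟ᶠ x of λ where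
        (yes refl) → contradiction (~-sym ua) xu
        (no a≢x) → contradiction (a , aa , a≢x) none })
      (yes (y , ay , y≢x)) → do
        M , (modM , (z , z∈M) , (t , at , t∉M) , M⊑A) , M-max ← maximal Proper
          (⁅ x ⁆ , (λ { _ _ m∈ m′∈ xm → subst (_ ~_) (trans (x∈⁅y⁆⇒x≡y x m∈) (≡-sym (x∈⁅y⁆⇒x≡y x m′∈))) xm })
                 , (x , x∈⁅x⁆ x) , (y , ay , λ y∈ → y≢x (x∈⁅y⁆⇒x≡y x y∈))
                 , λ w w∈ → subst A (≡-sym (x∈⁅y⁆⇒x≡y x w∈)) ax)
        p , q , (ap , aq , pq) , p∈M , q∉M ← crossing (_∈ M) (conn (M⊑A z z∈M) at) z∈M t∉M
        return (p , q , λ where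
          u (a , aa , ua) (pu ∷ qu ∷ []) no-fork {b} {c} ab ac ub uc →
            let D = λ y → A y × ¬ u ~ y
                C = Joined D p
                Cq : C q
                Cq = ((ap , ≁-sym pu) , (aq , ≁-sym qu) , pq) ◅ ε
                C⊑D : C ⊑ D
                C⊑D y = joined-end (ap , ≁-sym pu)
                modC : Module A C
                modC = nonneighbour-component-module no-fork ap (≁-sym pu)
                cover : ∀ w → A w → ¬ ¬ (w ∈ M ⊎ C w)
                cover w aw k = comprehension (λ y → y ∈ M ⊎ C y) λ (S , S≡) →
                  M-max S
                    ( (λ ax ¬x m∈ m′∈ → union-module {N = C} modM modC p∈M ε ax (¬x ∘ proj₂ (S≡ _))
                          (proj₁ (S≡ _) m∈) (proj₁ (S≡ _) m′∈))
                    , (p , proj₂ (S≡ p) (inj₁ p∈M))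
                    , (w , aw , k ∘ proj₁ (S≡ w))
                    , λ y y∈S → [ M⊑A y , proj₁ ∘ C⊑D y ] (proj₁ (S≡ y) y∈S) )
                    ( (λ y∈M → proj₂ (S≡ _) (inj₁ y∈M)) , q , proj₂ (S≡ q) (inj₂ Cq) , q∉M )
                ¬Cb : ¬ C b
                ¬Cb cb = proj₂ (C⊑D b cb) ub
            in ~-stable λ bc →
              cover b ab λ where
                (inj₂ cb) → ¬Cb cb
                -- `q` sees `p` and so all of the module `M`, in particular `b`; since `b` is
                -- outside the module `C` and sees `q`, it sees all of `C`. If `c` is in `M`, it is
                -- a neighbour of `q` missed by `u`, hence in `C` too.
                (inj₁ b∈M) →
                  let bq : b ~ q
                      bq = ~-sym (modM aq q∉M p∈M b∈M (~-sym pq))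
                      C⇒~ : ∀ {w} → C w → b ~ w
                      C⇒~ cw = modC ab ¬Cb Cq cw bq
                  in cover c ac λ where
                    (inj₂ cc) → bc (C⇒~ cc)
                    (inj₁ c∈M) → bc (C⇒~ (Cq ◅◅ ((aq , ≁-sym qu) , (ac , uc) , modM aq q∉M p∈M c∈M (~-sym pq)) ◅ ε)))
    where
    Proper : Subset n → Set
    Proper M = Module A (_∈ M) × ∃ (_∈ M) × (∃ λ t → A t × t ∉ M) × (∀ w → w ∈ M → A w)

-- Vertices attached to two anticomplete sets in a P7-free graph.

module SevenFree {n : ℕ} (G : Graph n) (P7-free : PFree 7 G) where
  open Neighbourhoods G
  open InducedPaths (adj G) (λ _ _ → ~-sym) ~-irrefl

  private
    ne : ∀ {m x y} → m ~ x → ¬ m ~ y → x ≢ y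
    ne e k refl = k e

  -- Distinctness of the seven vertices need not be supplied: any two non-consecutive ones are told
  -- apart by a third.
  no-P7 : ∀ {a b c d e f g : V} →
    a ~ b → ¬ a ~ c → ¬ a ~ d → ¬ a ~ e → ¬ a ~ f → ¬ a ~ g →
    b ~ c → ¬ b ~ d → ¬ b ~ e → ¬ b ~ f → ¬ b ~ g →
    c ~ d → ¬ c ~ e → ¬ c ~ f → ¬ c ~ g →
    d ~ e → ¬ d ~ f → ¬ d ~ g →
    e ~ f → ¬ e ~ g →
    f ~ g → ⊥
  no-P7 {a} {b} {c} {d} {e} {f} {g}
    ab ac ad ae af ag bc bd be bf bg cd ce cf cg de df dg ef eg fg =
    P7-free (induced-copy (a ∷ b ∷ c ∷ d ∷ e ∷ f ∷ g ∷ [])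
      ( ab , (ne′ cd ad , ac) ∷ (ne′ de ae , ad) ∷ (ne′ ef af , ae) ∷ (ne′ fg ag , af) ∷ (ne′ (~-sym fg) af , ag) ∷ []
      , bc , (ne ab ad , bd) ∷ (ne ab ae , be) ∷ (ne ab af , bf) ∷ (ne ab ag , bg) ∷ []
      , cd , (ne bc be , ce) ∷ (ne bc bf , cf) ∷ (ne bc bg , cg) ∷ []
      , de , (ne cd cf , df) ∷ (ne cd cg , dg) ∷ []
      , ef , (ne de dg , eg) ∷ []
      , fg , []
      , tt ))
    where
    ne′ : ∀ {x y m} → y ~ m → ¬ x ~ m → x ≢ y
    ne′ e k refl = k e

  -- The two forks join at `u` to the path z y x u x′ y′ z′.
  fork-fork : ∀ {A B u} → Anticomplete A B → Fork A u → Fork B u → ⊥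
  fork-fork anti (x , y , z , ax , ay , az , ux , xy , yz , uy , uz , xz)
                 (x′ , y′ , z′ , bx , by , bz , ux′ , xy′ , yz′ , uy′ , uz′ , xz′) =
    no-P7 (~-sym yz) (≁-sym xz) (≁-sym uz) (anti az bx) (anti az by) (anti az bz)
          (~-sym xy) (≁-sym uy) (anti ay bx) (anti ay by) (anti ay bz)
          (~-sym ux) (anti ax bx) (anti ax by) (anti ax bz)
          ux′ uy′ uz′ xy′ xz′ yz′

  one-sided : ∀ {A B} → Anticomplete A B → (T : V → Set) →
    (∀ u → T u → ∃ (Nb A u) × Good A u × Fork B u) → ¬ ¬ Cov 5 T
  one-sided {A} {B} anti T props = do
    d ← em (∃ T)
    case d of λ where
      (no none) → return (cov-none λ v t → none (v , t))
      (yes e) → do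
        v , tv , v-min ← minimal (fins n) (Nb A) T e
        let (a , aa , va) , _ , x , y , z , bx , by , bz , vx , xy , yz , vy , vz , xz = props v tv
        return (cov-by (v ∷ a ∷ x ∷ y ∷ z ∷ []) λ { u tu (vu ∷ au ∷ xu ∷ yu ∷ zu ∷ []) →
          -- Since `u` misses `a`, minimality of `v` leaves `u` a neighbour `a′` in `A` that `v`
          -- misses; `Good A u` makes `a′` adjacent to `a`, and u a′ a v x y z is a P7.
          ⋢⇒Priv (λ s → au (~-sym (proj₂ (v-min u tu s a (aa , va)))))
            λ (a′ , aa′ , ua′ , va′) →
              no-P7 ua′ (≁-sym au) (≁-sym vu) (≁-sym xu) (≁-sym yu) (≁-sym zu)
                    (proj₁ (proj₂ (props u tu)) aa′ aa ua′ (≁-sym au)) (≁-sym va′) (anti aa′ bx) (anti aa′ by) (anti aa′ bz)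
                    (~-sym va) (anti aa bx) (anti aa by) (anti aa bz)
                    vx vy vz xy xz yz })

  private
    -- The path w x a u b b′ v.
    no-outside-nonadjacent : ∀ {A B u v w x a b b′} → Anticomplete A B → Good A w → Good B u →
      A a → u ~ a → ¬ v ~ a → B b → u ~ b → ¬ v ~ b → B b′ → v ~ b′ → ¬ u ~ b′ → ¬ u ~ v →
      ¬ u ~ w → ¬ v ~ w → ¬ a ~ w → ¬ b ~ w → ¬ b′ ~ w → A x → w ~ x → ¬ u ~ x → ¬ v ~ x → ⊥
    no-outside-nonadjacent anti gw gu aa ua va bb ub vb bb′ vb′ ub′ uv uw vw aw bw bw′ ax wx ux vx =
      no-P7 wx (≁-sym aw) (≁-sym uw) (≁-sym bw) (≁-sym bw′) (≁-sym vw)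
            (gw ax aa wx (≁-sym aw)) (≁-sym ux) (anti ax bb) (anti ax bb′) (≁-sym vx)
            (~-sym ua) (anti aa bb) (anti aa bb′) (≁-sym va)
            ub ub′ uv (gu bb bb′ ub ub′) (≁-sym vb) (~-sym vb′)

    -- The path t w x a u v b.
    outside-constant : ∀ {A B u v w t x a b} → Anticomplete A B → Good A w →
      A a → u ~ a → ¬ v ~ a → B b → v ~ b → ¬ u ~ b → u ~ v →
      ¬ u ~ w → ¬ v ~ w → ¬ a ~ w → ¬ b ~ w → ¬ u ~ t → ¬ v ~ t → ¬ a ~ t → ¬ b ~ t →
      w ~ t → A x → w ~ x → ¬ u ~ x → ¬ v ~ x → t ~ x
    outside-constant anti gw aa ua va bb vb ub uv uw vw aw bw ut vt at bt wt ax wx ux vx =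
      ~-stable λ tx →
      no-P7 (~-sym wt) tx (≁-sym at) (≁-sym ut) (≁-sym vt) (≁-sym bt)
            wx (≁-sym aw) (≁-sym uw) (≁-sym vw) (≁-sym bw)
            (gw ax aa wx (≁-sym aw)) (≁-sym ux) (≁-sym vx) (anti ax bb)
            (~-sym ua) (≁-sym va) (anti aa bb)
            uv ub vb

    -- The path w′ w y u a x t.
    no-second-outside : ∀ {A B w w′ y u a x t} → Anticomplete A B → Good A t →
      w ~ w′ → B y → w ~ y → ¬ w′ ~ y → u ~ y → A a → u ~ a →
      ¬ u ~ w → ¬ u ~ w′ → ¬ u ~ t → ¬ a ~ w → ¬ a ~ w′ → ¬ a ~ t → ¬ y ~ t → ¬ w ~ t → ¬ w′ ~ t →
      A x → t ~ x → ¬ u ~ x → ¬ w ~ x → ¬ w′ ~ x → ⊥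
    no-second-outside anti gt ww by wy w′y uy aa ua uw uw′ ut aw aw′ at yt wt w′t ax tx ux wx w′x =
      no-P7 (~-sym ww) w′y (≁-sym uw′) (≁-sym aw′) w′x w′t
            wy (≁-sym uw) (≁-sym aw) wx wt
            (~-sym uy) (≁-sym (anti aa by)) (≁-sym (anti ax by)) yt
            ua ux ut (~-sym (gt ax aa tx (≁-sym at))) at (~-sym tx)

  module _ {A B : V → Set} (anti : Anticomplete A B) where

    -- Incomparability in both `A` and `B`, with its four witnesses kept because they enter the
    -- covers.
    Bad : V → V → Set
    Bad u v = (Priv A u v × Priv A v u) × (Priv B u v × Priv B v u)

    private
      Nb² : V × V → V → Set
      Nb² (u , v) a = A a × ((u ~ a) ⊎ (v ~ a))

      Rest : (V → Set) → List V → V → Set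
      Rest T xs v = T v × Far xs v

    -- `bi-ranking` yields `m` whose neighbourhood in `A` or in `B` is contained in that of each
    -- vertex of `T`; one neighbour of `m` on either side therefore suffices.
    no-bad⇒cov : (T : V → Set) → (∀ u → T u → ∃ (Nb A u) × ∃ (Nb B u)) →
      (∀ u v → T u → T v → ¬ Bad u v) → ¬ ¬ Cov 2 T
    no-bad⇒cov T nbs no-bad = do
      d ← em (∃ T)
      case d of λ where
        (no none) → return (cov-none λ v t → none (v , t))
        (yes e) → do
          m , tm , above ← bi-ranking (fins n) (Nb A) (Nb B) T comparable e
          let (a , aa , ma) , (b , bb , mb) = nbs m tm
          return (cov-by (a ∷ b ∷ []) λ { v tv (av ∷ bv ∷ []) → above v tv λ where
            (inj₁ s) → av (~-sym (proj₂ (s a (aa , ma))))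
            (inj₂ s) → bv (~-sym (proj₂ (s b (bb , mb)))) })
      where
      comparable : ∀ x y → T x → T y → ¬ ¬ ((Nb A x ⊑ Nb A y ⊎ Nb A y ⊑ Nb A x) ⊎ (Nb B x ⊑ Nb B y ⊎ Nb B y ⊑ Nb B x))
      comparable x y tx ty k =
        ⋢⇒Priv (k ∘ inj₁ ∘ inj₁) λ p → ⋢⇒Priv (k ∘ inj₁ ∘ inj₂) λ p′ →
        ⋢⇒Priv (k ∘ inj₂ ∘ inj₁) λ q → ⋢⇒Priv (k ∘ inj₂ ∘ inj₂) λ q′ →
        no-bad x y tx ty ((p , p′) , (q , q′))

    TwoSided : (V → Set) → Set
    TwoSided T = ∀ u → T u → (∃ (Nb A u) × ∃ (Nb B u)) × Good A u × Good B u

    private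
      one-of : ∀ {u v y} → ¬ (¬ u ~ y × ¬ v ~ y) → u ~ y ⊎ v ~ y
      one-of {u} {v} {y} k with adj G u y ≟ᵇ true
      ... | yes e = inj₁ e
      ... | no ¬e = inj₂ (~-stable λ ¬e′ → k (¬e , ¬e′))

    -- After removing the neighbourhoods of a minimal bad pair u, v and its private neighbours, f w is
    -- constant on the connected components of what remains, and non-empty on each remaining bad pair
    -- by minimality.  A bad pair w, w′ with minimal f w yields x and y whose neighbourhoods meet all
    -- other bad pairs.
    no-nonadjacent-bad⇒cov : (T : V → Set) → TwoSided T →
      (∀ u v → T u → T v → ¬ u ~ v → ¬ Bad u v) → ¬ ¬ Cov 10 T
    no-nonadjacent-bad⇒cov T props bad⇒adj = do
      d ← em (∃ λ ((u , v) : V × V) → T u × T v × Bad u v)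
      case d of λ where
        (no none) → do
          c ← no-bad⇒cov T (λ u tu → proj₁ (props u tu)) λ u v tu tv bad → none ((u , v) , tu , tv , bad)
          return (cov-≤ (m≤m+n 2 8) c)
        (yes e) → do
          (u , v) , (tu , tv , bad) , uv-min ← minimal (pairs (fins n)) Nb² _ e
          let (a , aa , ua , va) , (a′ , aa′ , va′ , ua′) = proj₁ bad
              (b , bb , ub , vb) , (b′ , bb′ , vb′ , ub′) = proj₂ bad
              uv : u ~ v
              uv = ~-stable λ k → bad⇒adj u v tu tv k bad
              xs = u ∷ v ∷ a ∷ a′ ∷ b ∷ b′ ∷ []
              W = Rest T xs
              f : V → V → Set
              f w x = A x × w ~ x × ¬ u ~ x × ¬ v ~ x
              constA : ∀ {w t x} → W w → W t → w ~ t → A x → w ~ x → ¬ u ~ x → ¬ v ~ x → t ~ x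
              constA = λ { {w} (tw , uw ∷ vw ∷ aw ∷ aw′ ∷ bw ∷ bw′ ∷ []) (_ , ut ∷ vt ∷ at ∷ at′ ∷ bt ∷ bt′ ∷ []) →
                outside-constant anti (proj₁ (proj₂ (props w tw))) aa ua va bb′ vb′ ub′ uv uw vw aw bw′ ut vt at bt′ }
              constB : ∀ {w t x} → W w → W t → w ~ t → B x → w ~ x → ¬ u ~ x → ¬ v ~ x → t ~ x
              constB = λ { {w} (tw , uw ∷ vw ∷ aw ∷ aw′ ∷ bw ∷ bw′ ∷ []) (_ , ut ∷ vt ∷ at ∷ at′ ∷ bt ∷ bt′ ∷ []) →
                outside-constant (anti-sym anti) (proj₂ (proj₂ (props w tw))) bb ub vb aa′ va′ ua′ uv uw vw bw aw′ ut vt bt at′ }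
          d′ ← em (∃ λ ((w , w′) : V × V) → W w × W w′ × Bad w w′)
          case d′ of λ where
            (no none) → do
              c ← no-bad⇒cov W (λ w (tw , _) → proj₁ (props w tw)) λ w w′ ww ww′ bad′ → none ((w , w′) , ww , ww′ , bad′)
              return (cov-≤ (m≤m+n 8 2) (cov-rest xs c))
            (yes e′) → do
              (w , w′) , (W-w , W-w′ , bad′) , w-min ← minimal (pairs (fins n)) (λ p → f (proj₁ p)) _ e′
              let far-w  = proj₂ W-w
                  far-w′ = proj₂ W-w′
                  ww′ : w ~ w′
                  ww′ = ~-stable λ k → bad⇒adj w w′ (proj₁ W-w) (proj₁ W-w′) k bad′
                  (y , by , wy , w′y) = proj₁ (proj₂ bad′)
                  uy⊎vy : u ~ y ⊎ v ~ y
                  uy⊎vy = one-of λ (uy , vy) → w′y (constB W-w W-w′ ww′ by wy uy vy)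
              -- Without such an `x`, `w` and `w′` have all their neighbours in `A` among those of
              -- `u` and `v`, and minimality makes one of them see `a`, from which both are far.
              x , ax , wx , ux , vx ← (λ k →
                let shrink : Nb² (w , w′) ⊑ Nb² (u , v)
                    shrink = λ where
                      z (az , inj₁ wz) → az , one-of λ (uz , vz) → k (z , az , wz , uz , vz)
                      z (az , inj₂ w′z) → az , one-of λ (uz , vz) →
                        k (z , az , constA W-w′ W-w (~-sym ww′) az w′z uz vz , uz , vz)
                in case (proj₂ (uv-min (w , w′) (proj₁ W-w , proj₁ W-w′ , bad′) shrink a (aa , inj₁ ua))) of
                  far-both far-w far-w′)
              c ← no-bad⇒cov (Rest W (x ∷ y ∷ [])) (λ t ((T-t , _) , _) → proj₁ (props t T-t)) λ where
                -- If `f t ⊑ f w`, minimality gives the converse and `t` sees `x`, against `xt`.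
                -- Otherwise some `z` in `f t` is missed by `w`; by `constA`, `w′` misses `z` and
                -- both `w` and `w′` miss `t`, so w′ w y u a z t is a P7, or the same path with `v`
                -- and `a′`.
                t t′ (W-t , xt ∷ yt ∷ []) (W-t′ , _) bad″ →
                  (λ k → xt (~-sym (proj₁ (proj₂ (w-min (t , t′) (W-t , W-t′ , bad″)
                    (λ z (az , tz , uz , vz) → az , ~-stable (λ wz → k (z , az , tz , uz , vz , wz)) , uz , vz)
                    x (ax , wx , ux , vx))))))
                  λ (z , az , tz , uz , vz , wz) →
                  let w′z : ¬ w′ ~ z
                      w′z = λ e → wz (constA W-w′ W-w (~-sym ww′) az e uz vz)
                      wt : ¬ w ~ t
                      wt = λ e → wz (constA W-t W-w (~-sym e) az tz uz vz)
                      w′t : ¬ w′ ~ t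
                      w′t = λ e → w′z (constA W-t W-w′ (~-sym e) az tz uz vz)
                      goodA = proj₁ (proj₂ (props t (proj₁ W-t)))
                  in case (far-w , far-w′ , proj₂ W-t) of λ where
                    (uw ∷ vw ∷ aw ∷ aw′ ∷ _ , uw′ ∷ vw′ ∷ aw″ ∷ aw‴ ∷ _ , ut ∷ vt ∷ at ∷ at′ ∷ _) →
                      [ (λ uy → no-second-outside anti goodA ww′ by wy w′y uy aa ua
                                  uw uw′ ut aw aw″ at yt wt w′t az tz uz wz w′z)
                      , (λ vy → no-second-outside anti goodA ww′ by wy w′y vy aa′ va′
                                  vw vw′ vt aw′ aw‴ at′ yt wt w′t az tz vz wz w′z)
                      ] uy⊎vy
              return (cov-rest xs (cov-rest (x ∷ y ∷ []) c))
      where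
      far-both : ∀ {u v a zs w w′} → Far (u ∷ v ∷ a ∷ zs) w → Far (u ∷ v ∷ a ∷ zs) w′ → w ~ a ⊎ w′ ~ a → ⊥
      far-both (_ ∷ _ ∷ aw ∷ _) (_ ∷ _ ∷ aw′ ∷ _) = [ aw ∘ ~-sym , aw′ ∘ ~-sym ]

    -- Minimality of N(u) ∪ N(v) in A leaves no non-adjacent bad pair after the removal.
    two-sided : (T : V → Set) → TwoSided T → ¬ ¬ Cov 16 T
    two-sided T props = do
      d ← em (∃ λ ((u , v) : V × V) → T u × T v × ¬ u ~ v × Bad u v)
      case d of λ where
        (no none) → do
          c ← no-nonadjacent-bad⇒cov T props λ u v tu tv k bad → none ((u , v) , tu , tv , k , bad)
          return (cov-≤ (m≤m+n 10 6) c)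
        (yes e) → do
          (u , v) , (tu , tv , uv , bad) , uv-min ← minimal (pairs (fins n)) Nb² _ e
          let (a , aa , ua , va) , (a′ , aa′ , va′ , ua′) = proj₁ bad
              (b , bb , ub , vb) , (b′ , bb′ , vb′ , ub′) = proj₂ bad
              xs = u ∷ v ∷ a ∷ a′ ∷ b ∷ b′ ∷ []
              W = Rest T xs
              inside : ∀ {w x} → W w → A x → w ~ x → u ~ x ⊎ v ~ x
              inside = λ { {w} (tw , uw ∷ vw ∷ aw ∷ aw′ ∷ bw ∷ bw′ ∷ []) ax wx → one-of λ (ux , vx) →
                no-outside-nonadjacent anti (proj₁ (proj₂ (props w tw))) (proj₂ (proj₂ (props u tu)))
                  aa ua va bb ub vb bb′ vb′ ub′ uv uw vw aw bw bw′ ax wx ux vx }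
          c ← no-nonadjacent-bad⇒cov W (λ w (tw , _) → props w tw) λ where
            w w′ W-w@(tw , _ ∷ _ ∷ aw ∷ _) W-w′@(tw′ , _ ∷ _ ∷ aw′ ∷ _) ww′ bad′ →
              [ aw ∘ ~-sym , aw′ ∘ ~-sym ]
                -- By `inside`, the neighbours of `w` and `w′` in `A` are among those of `u` and
                -- `v`, so minimality puts `a` next to `w` or `w′`.
                (proj₂ (uv-min (w , w′) (tw , tw′ , ww′ , bad′)
                  (λ z (az , wz⊎w′z) → az , [ inside W-w az , inside W-w′ az ] wz⊎w′z) a (aa , inj₁ ua)))
          return (cov-rest xs c)

  -- The bound is 4 + (5 + (5 + 16)): the ends of two dominating edges, a class with forks into `B`
  -- only, one with forks into `A` only, and the class without forks.
  separator-cover : ∀ {A B} (S : V → Set) → ∃ A → ∃ B → Connected A → Connected B → Anticomplete A B →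
    (∀ s → S s → ∃ (Nb A s) × ∃ (Nb B s)) → ¬ ¬ Cov 30 S
  separator-cover {A} {B} S eA eB connA connB anti nbs = do
    p , q , goodA ← dominating-edge connA eA
    p′ , q′ , goodB ← dominating-edge connB eB
    let R = λ v → S v × Far (p ∷ q ∷ p′ ∷ q′ ∷ []) v
        goodA′ : ∀ {v} → R v → ¬ Fork A v → Good A v
        goodA′ = λ { {v} (sv , pv ∷ qv ∷ _) → goodA v (proj₁ (nbs v sv)) (pv ∷ qv ∷ []) }
        goodB′ : ∀ {v} → R v → ¬ Fork B v → Good B v
        goodB′ = λ { {v} (sv , _ ∷ _ ∷ pv ∷ qv ∷ []) → goodB v (proj₂ (nbs v sv)) (pv ∷ qv ∷ []) }
    c₁ ← one-sided anti (λ v → R v × ¬ Fork A v × Fork B v)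
           λ v (rv , ¬f , f) → proj₁ (nbs v (proj₁ rv)) , goodA′ rv ¬f , f
    c₂ ← one-sided (anti-sym anti) (λ v → R v × Fork A v × ¬ Fork B v)
           λ v (rv , f , ¬f) → proj₂ (nbs v (proj₁ rv)) , goodB′ rv ¬f , f
    c₃ ← two-sided anti (λ v → R v × ¬ Fork A v × ¬ Fork B v)
           λ v (rv , ¬f , ¬f′) → nbs v (proj₁ rv) , goodA′ rv ¬f , goodB′ rv ¬f′
    return (cov-rest (p ∷ q ∷ p′ ∷ q′ ∷ []) (cov-⊎ split c₁ (cov-⊎ (λ _ → return) c₂ c₃)))
    where
    split : ∀ {R : V → Set} v → R v → ¬ ¬ (R v × ¬ Fork A v × Fork B v ⊎
      (R v × Fork A v × ¬ Fork B v ⊎ R v × ¬ Fork A v × ¬ Fork B v))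
    split v rv = do
      d ← em (Fork A v)
      d′ ← em (Fork B v)
      case d , d′ of λ where
        (yes f , yes f′) → contradiction f′ (fork-fork anti f)
        (yes f , no ¬f′) → return (inj₂ (inj₁ (rv , f , ¬f′)))
        (no ¬f , yes f′) → return (inj₁ (rv , ¬f , f′))
        (no ¬f , no ¬f′) → return (inj₂ (inj₂ (rv , ¬f , ¬f′)))

-- Rotation of cycles, and cycles meeting a clique separator.

IsCycle : ∀ {n t} → Adj n → (Fin t → Fin n) → Set
IsCycle A f = Injective _≡_ _≡_ f × (∀ i j → i ≢ j → (A (f i) (f j) ≡ true ⇔ CycleEdge i j))

rotate : ∀ {k} → Fin (suc k) → Fin (suc k)
rotate {k} zero = fromℕ k
rotate (suc i) = inject₁ i

rotate-injective : ∀ {k} (i j : Fin (suc k)) → rotate i ≡ rotate j → i ≡ j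
rotate-injective zero zero _ = refl
rotate-injective zero (suc j) eq = contradiction eq fromℕ≢inject₁
rotate-injective (suc i) zero eq = contradiction (≡-sym eq) fromℕ≢inject₁
rotate-injective (suc i) (suc j) eq = cong suc (inject₁-injective eq)

private
  last-edge⇒ : ∀ {k} (j : Fin k) → CycleEdge (fromℕ k) (inject₁ j) → CycleEdge zero (suc j)
  last-edge⇒ {k} j c rewrite toℕ-fromℕ k | toℕ-inject₁ j = case c of λ where
    (inj₁ (inj₁ e)) → contradiction (≤-trans (n≤1+n k) (≤-reflexive e)) (<⇒≱ (toℕ<n j))
    (inj₁ (inj₂ e)) → inj₂ (inj₂ (cong suc e , refl))
    (inj₂ (inj₁ (_ , e))) → inj₁ (inj₁ (cong suc (≡-sym e)))
    (inj₂ (inj₂ (e , _))) → contradiction (suc-injective e) (<⇒≢ (toℕ<n j))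

  last-edge⇐ : ∀ {k} (j : Fin k) → CycleEdge zero (suc j) → CycleEdge (fromℕ k) (inject₁ j)
  last-edge⇐ {k} j c rewrite toℕ-fromℕ k | toℕ-inject₁ j = case c of λ where
    (inj₁ (inj₁ e)) → inj₂ (inj₁ (refl , ≡-sym (suc-injective e)))
    (inj₁ (inj₂ ()))
    (inj₂ (inj₁ (_ , ())))
    (inj₂ (inj₂ (e , _))) → inj₁ (inj₂ (suc-injective e))

  inner-edge⇒ : ∀ {k} (i j : Fin k) → CycleEdge (inject₁ i) (inject₁ j) → CycleEdge (suc i) (suc j)
  inner-edge⇒ i j c rewrite toℕ-inject₁ i | toℕ-inject₁ j = case c of λ where
    (inj₁ (inj₁ e)) → inj₁ (inj₁ (cong suc e))
    (inj₁ (inj₂ e)) → inj₁ (inj₂ (cong suc e))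
    (inj₂ (inj₁ (e , _))) → contradiction (suc-injective e) (<⇒≢ (toℕ<n i))
    (inj₂ (inj₂ (e , _))) → contradiction (suc-injective e) (<⇒≢ (toℕ<n j))

  inner-edge⇐ : ∀ {k} (i j : Fin k) → CycleEdge (suc i) (suc j) → CycleEdge (inject₁ i) (inject₁ j)
  inner-edge⇐ i j c rewrite toℕ-inject₁ i | toℕ-inject₁ j = case c of λ where
    (inj₁ (inj₁ e)) → inj₁ (inj₁ (suc-injective e))
    (inj₁ (inj₂ e)) → inj₁ (inj₂ (suc-injective e))
    (inj₂ (inj₁ (_ , ())))
    (inj₂ (inj₂ (_ , ())))

rotate-edge⇒ : ∀ {k} (i j : Fin (suc k)) → i ≢ j → CycleEdge (rotate i) (rotate j) → CycleEdge i j
rotate-edge⇒ zero zero ne _ = contradiction refl ne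
rotate-edge⇒ zero (suc j) _ c = last-edge⇒ j c
rotate-edge⇒ (suc i) zero _ c = cycle-sym (last-edge⇒ i (cycle-sym c))
rotate-edge⇒ (suc i) (suc j) _ c = inner-edge⇒ i j c

rotate-edge⇐ : ∀ {k} (i j : Fin (suc k)) → i ≢ j → CycleEdge i j → CycleEdge (rotate i) (rotate j)
rotate-edge⇐ zero zero ne _ = contradiction refl ne
rotate-edge⇐ zero (suc j) _ c = last-edge⇐ j c
rotate-edge⇐ (suc i) zero _ c = cycle-sym (last-edge⇐ i (cycle-sym c))
rotate-edge⇐ (suc i) (suc j) _ c = inner-edge⇐ i j c

rotate-cycle : ∀ {n k} {A : Adj n} (f : Fin (suc k) → Fin n) → IsCycle A f → IsCycle A (f ∘ rotate)
rotate-cycle f (inj , edges) = (λ {i} {j} eq → rotate-injective i j (inj eq)) , λ i j i≢j →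
  let open Equivalence (edges (rotate i) (rotate j) (i≢j ∘ rotate-injective i j))
  in mk⇔ (rotate-edge⇒ i j i≢j ∘ to) (from ∘ rotate-edge⇐ i j i≢j)

-- Downward induction from the last index: a rotation moves the last entry to position zero and the
-- entry at `inject₁ i` to `suc i`.
cycle-from : ∀ {n k} {A : Adj n} (i : Fin (suc k)) (f : Fin (suc k) → Fin n) → IsCycle A f →
  ∃ λ (g : Fin (suc k) → Fin n) → IsCycle A g × g zero ≡ f i
cycle-from {n} {k} {A} = >-weakInduction
  (λ i → (f : Fin (suc k) → Fin n) → IsCycle A f →
    ∃ λ (g : Fin (suc k) → Fin n) → IsCycle A g × g zero ≡ f i)
  (λ f c → f ∘ rotate , rotate-cycle {A = A} f c , refl)
  (λ i rec f c → rec (f ∘ rotate) (rotate-cycle {A = A} f c))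

first-exit : ∀ {k} (P : Fin (suc k) → Set) → P zero → ∀ j → ¬ P j →
  ¬ ¬ ∃ λ (a : Fin k) → P (inject₁ a) × ¬ P (suc a) × toℕ a < toℕ j
first-exit P p zero ¬p = contradiction p ¬p
first-exit {suc k} P p (suc j) ¬p = em (P (suc zero)) >>= λ where
  (no ¬q) → return (zero , p , ¬q , s≤s z≤n)
  (yes q) → do
    a , pa , ¬pa , lt ← first-exit (P ∘ suc) q j ¬p
    return (suc a , pa , ¬pa , s≤s lt)

-- The second alternative serves a return across the closing edge of a cycle, where `P` holds again
-- at position zero.
last-entry : ∀ {k} (P : Fin (suc k) → Set) → ∀ j → ¬ P j →
  ¬ ¬ ((∃ λ (b : Fin k) → ¬ P (inject₁ b) × P (suc b) × toℕ j ≤ toℕ b) ⊎ ¬ P (fromℕ k))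
last-entry {zero} P zero ¬p = return (inj₂ ¬p)
last-entry {suc k} P zero ¬p = em (P (suc zero)) >>= λ where
  (yes q) → return (inj₁ (zero , ¬p , q , z≤n))
  (no ¬q) → last-entry (P ∘ suc) zero ¬q >>= λ where
    (inj₁ (b , ¬pb , pb , _)) → return (inj₁ (suc b , ¬pb , pb , z≤n))
    (inj₂ ¬pl) → return (inj₂ ¬pl)
last-entry {suc k} P (suc j) ¬p = last-entry (P ∘ suc) j ¬p >>= λ where
  (inj₁ (b , ¬pb , pb , le)) → return (inj₁ (suc b , ¬pb , pb , s≤s le))
  (inj₂ ¬pl) → return (inj₂ ¬pl)

-- A cycle meeting both C and the complement of C ∪ S passes through S on either side, and the two
-- passages are not consecutive.
cycle-separator : ∀ {n k} {A : Adj n} (C S : Fin n → Set) (f : Fin (suc k) → Fin n) → IsCycle A f →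
  (∀ {x y} → C x → A x y ≡ true → ¬ C y → S y) →
  (∀ {x y} → S x → S y → x ≢ y → A x y ≡ true) →
  C (f zero) → ∀ j → ¬ ¬ (C (f j) ⊎ S (f j))
cycle-separator {k = k} {A} C S f (inj , edges) leave clique c₀ j ¬in =
  first-exit (C ∘ f) c₀ j (¬in ∘ inj₁) λ (a , ca , ¬ca , a<j) →
  let sa = enters (inject₁ a) (suc a) (inj₁ (inj₁ (cong suc (toℕ-inject₁ a)))) ca ¬ca in
  last-entry (C ∘ f) j (¬in ∘ inj₁) λ where
    (inj₁ (b , ¬cb , cb , j≤b)) →
      clash a (inject₁ b) sa (enters (suc b) (inject₁ b) (inj₁ (inj₂ (cong suc (toℕ-inject₁ b)))) cb ¬cb)
        a<j (≤-trans j≤b (≤-reflexive (≡-sym (toℕ-inject₁ b))))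
    (inj₂ ¬cl) →
      clash a (fromℕ k) sa (enters zero (fromℕ k) (inj₂ (inj₂ (cong suc (toℕ-fromℕ k) , refl))) c₀ ¬cl)
        a<j (≤-trans (≤-pred (toℕ<n j)) (≤-reflexive (≡-sym (toℕ-fromℕ k))))
  where
  index≢ : ∀ {i : Fin (suc k)} → S (f i) → toℕ i ≢ toℕ j
  index≢ s eq = ¬in (inj₂ (subst (S ∘ f) (toℕ-injective eq) s))
  enters : ∀ i i′ → CycleEdge i i′ → C (f i) → ¬ C (f i′) → S (f i′)
  enters i i′ e c ¬c = leave c (Equivalence.from (edges i i′ λ eq → ¬c (subst (C ∘ f) eq c)) e) ¬c
  -- Position `j` is strictly between `suc p` and `q`, and `suc p` is not zero, so these two are not
  -- consecutive even across the closing edge.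
  clash : ∀ (p : Fin k) q → S (f (suc p)) → S (f q) → toℕ p < toℕ j → toℕ j ≤ toℕ q → ⊥
  clash p q sp sq p<j j≤q = case Equivalence.to (edges (suc p) q p≢q) (clique sp sq (p≢q ∘ inj)) of λ where
      (inj₁ (inj₁ e)) → <⇒≱ j<q (≤-trans (≤-reflexive (≡-sym e)) p′<j)
      (inj₁ (inj₂ e)) → <⇒≱ p<j (≤-trans j≤q (≤-reflexive (suc-injective e)))
      (inj₂ (inj₁ (_ , e))) → n≮0 (subst (toℕ j <_) e j<q)
      (inj₂ (inj₂ (_ , ())))
    where
    p′<j : suc (toℕ p) < toℕ j
    p′<j = ≤∧≢⇒< p<j (index≢ sp)
    j<q : toℕ j < toℕ q
    j<q = ≤∧≢⇒< j≤q (index≢ sq ∘ ≡-sym)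
    p≢q : suc p ≢ q
    p≢q refl = <-irrefl refl (<-trans p′<j j<q)

-- Components of G - Ω, and two properties of potential maximal cliques.

module Components {n : ℕ} (G : Graph n) (Ω : Subset n) where
  open Neighbourhoods G

  Out : V → Set
  Out d = d ∉ Ω

  -- A component of G - Ω is represented by any of its vertices `d`; for `u` in Ω this is membership
  -- in the neighbourhood of that component.
  Link : V → V → Set
  Link d u = ∃ λ e → Joined Out d e × Out e × e ~ u

  link-move : ∀ {d e u} → Joined Out d e → Link d u → Link e u
  link-move de (x , dx , ox , xu) = x , joined-sym de ◅◅ dx , ox , xu

  link-edge : ∀ {d u} → Out d → d ~ u → Link d u
  link-edge od e = _ , ε , od , e

  component-connected : ∀ {d} → Connected (Joined Out d)
  component-connected {d} dx dy = within dx (joined-sym dx ◅◅ dy)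
    where
    within : ∀ {x y} → Joined Out d x → Joined Out x y → Joined (Joined Out d) x y
    within dx ε = ε
    within dx (s@(_ , _ , e) ◅ ss) = (dx , dx ◅◅ s ◅ ε , e) ◅ within (dx ◅◅ s ◅ ε) ss

module Completion {n : ℕ} (G : Graph n) (Ω : Subset n) (F : Adj n)
  (minimal-completion : MinimalChordalCompletion G F) (max-clique : IsMaximalClique (G +E F) Ω) where
  open Neighbourhoods G
  open Components G Ω

  private
    F-sym : ∀ u v → F u v ≡ F v u
    F-sym = proj₁ (proj₁ (proj₁ minimal-completion))

    F-nonedge : ∀ u v → F u v ≡ true → adj G u v ≡ false × u ≢ v
    F-nonedge = proj₂ (proj₁ (proj₁ minimal-completion))

    ~⇒+E : ∀ {F′ : Adj n} {u v} → u ~ v → (G +E F′) u v ≡ true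
    ~⇒+E {F′} {u} {v} e = cong (_∨ F′ u v) e

    H : Adj n
    H = G +E F

    +E-case : ∀ {F′ : Adj n} {u v} → (G +E F′) u v ≡ true → u ~ v ⊎ F′ u v ≡ true
    +E-case {F′} {u} {v} h with adj G u v in eq
    ... | true = inj₁ refl
    ... | false = inj₂ h

    F⇒+E : ∀ {F′ : Adj n} {u v} → F′ u v ≡ true → (G +E F′) u v ≡ true
    F⇒+E {F′} {u} {v} f = trans (cong (adj G u v ∨_) f) (∨-zeroʳ (adj G u v))

    H-sym : ∀ u v → H u v ≡ true → H v u ≡ true
    H-sym u v h = trans (≡-sym (cong₂ _∨_ (Defs.sym G u v) (F-sym u v))) h

    H-irrefl : ∀ v → ¬ H v v ≡ true
    H-irrefl v h = [ ~-irrefl v , (λ f → proj₂ (F-nonedge v v f) refl) ] (+E-case {F} h)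

  open InducedPaths H H-sym H-irrefl

  -- By `complete-vertex`, a component seen by all of Ω has a vertex complete to Ω in the chordal
  -- graph `H`, which contradicts maximality of the clique.
  not-full : ∀ {d} → Out d → ¬ (∀ u → u ∈ Ω → Link d u)
  not-full {d} od full =
    complete-vertex (proj₂ (proj₁ minimal-completion)) {K = _∈ Ω} {C = Joined Out d} (λ k∈ c → joined-end od c k∈)
      (λ k∈ k′∈ → proj₁ max-clique _ _ k∈ k′∈)
      (λ cx cy → gmap id (λ (cx , cy , e) → cx , cy , ~⇒+E {F} e) (component-connected cx cy))
      (λ {k} k∈ → let e , de , _ , ek = full k k∈ in e , de , ~⇒+E {F} (~-sym ek))
      (d , ε)
      λ (c , cc , all) → proj₂ max-clique c (joined-end od cc) all

  -- Otherwise delete from F the edge uv, all edges between components of G − Ω and all edges from a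
  -- component to the vertices of Ω it does not see: the rest is still chordal.
  linked : ∀ {u v} → u ∈ Ω → v ∈ Ω → u ≢ v → ¬ u ~ v → ¬ ¬ ∃ λ d → Out d × Link d u × Link d v
  linked {u} {v} u∈ v∈ u≢v uv none = ¬¬-Π (λ x → ¬¬-Π λ y → em (Kept x y)) contra
    where
    Kept : V → V → Set
    Kept x y = (x ∈ Ω → y ∈ Ω → ¬ (x ≡ u × y ≡ v) × ¬ (x ≡ v × y ≡ u)) ×
      (Out x → Out y → Joined Out x y) × (Out x → y ∈ Ω → Link x y) × (x ∈ Ω → Out y → Link y x)

    kept-sym : ∀ {x y} → Kept x y → Kept y x
    kept-sym (a , b , c , d) =
      (λ y∈ x∈ → (λ (p , q) → proj₂ (a x∈ y∈) (q , p)) , (λ (p , q) → proj₁ (a x∈ y∈) (q , p))) ,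
      (λ oy ox → joined-sym (b ox oy)) , (λ oy x∈ → d x∈ oy) , (λ y∈ ox → c ox y∈)

    kept-edge : ∀ {x y} → x ~ y → Kept x y
    kept-edge e =
      (λ _ _ → (λ { (refl , refl) → uv e }) , λ { (refl , refl) → uv (~-sym e) }) ,
      (λ ox oy → (ox , oy , e) ◅ ε) , (λ ox _ → link-edge ox e) , λ _ oy → link-edge oy (~-sym e)

    kept-in-Ω : ∀ {x y} → x ∈ Ω → y ∈ Ω → ¬ (x ≡ u × y ≡ v) → ¬ (x ≡ v × y ≡ u) → Kept x y
    kept-in-Ω x∈ y∈ p q = (λ _ _ → p , q) , (λ ox → contradiction x∈ ox) , (λ ox → contradiction x∈ ox) ,
      λ _ oy → contradiction y∈ oy

    contra : (∀ x y → Dec (Kept x y)) → ⊥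
    contra Kept? = proj₁ (proj₁ (kept′ F′uv) u∈ v∈) (refl , refl)
      where
      F′ : Adj n
      F′ x y = F x y ∧ does (Kept? x y)

      F′⇒ : ∀ x y → F′ x y ≡ true → F x y ≡ true × Kept x y
      F′⇒ x y e with F x y | Kept? x y
      ... | true | yes k = refl , k

      F′⇐ : ∀ x y → F x y ≡ true → Kept x y → F′ x y ≡ true
      F′⇐ x y e k with F x y | Kept? x y
      ... | true | yes _ = refl
      ... | true | no ¬k = contradiction k ¬k

      kept′ : ∀ {x y} → F′ x y ≡ true → Kept x y
      kept′ = proj₂ ∘ F′⇒ _ _

      Fuv : F u v ≡ true
      Fuv = [ (λ e → contradiction e uv) , id ] (+E-case {F} (proj₁ max-clique u v u∈ v∈ u≢v))

      F′-nonedge : IsNonEdgeSet G F′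
      F′-nonedge =
        (λ x y → cong₂ _∧_ (F-sym x y) (does-⇔ (mk⇔ kept-sym kept-sym) (Kept? x y) (Kept? y x))) ,
        λ x y e → F-nonedge x y (proj₁ (F′⇒ x y e))

      H′ : Adj n
      H′ = G +E F′

      H′⇒ : ∀ {x y} → H′ x y ≡ true → H x y ≡ true × Kept x y
      H′⇒ {x} {y} h = case +E-case {F′} h of λ where
        (inj₁ e) → ~⇒+E {F} e , kept-edge e
        (inj₂ f) → F⇒+E {F} (proj₁ (F′⇒ x y f)) , proj₂ (F′⇒ x y f)

      H′⇐ : ∀ {x y} → H x y ≡ true → Kept x y → H′ x y ≡ true
      H′⇐ {x} {y} h k = case +E-case {F} h of λ where
        (inj₁ e) → ~⇒+E {F′} e
        (inj₂ f) → F⇒+E {F′} (F′⇐ x y f k)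

      -- In `H′`, Ω is a clique up to the pair `u`, `v`. On a hole both 0, 2 and 1, 3 are
      -- non-adjacent positions, which would force three distinct vertices into this pair.
      inside-Ω : ∀ {k} (f : Fin k → V) → 4 ≤ k → IsCycle H′ f → ¬ (∀ i → f i ∈ Ω)
      inside-Ω f (s≤s (s≤s (s≤s (s≤s z≤n)))) (inj , edges) all =
        opposite {zero} {suc (suc zero)} (λ ()) nonadj₀₂ λ (p₀ , p₂) →
        opposite {suc zero} {suc (suc (suc zero))} (λ ()) nonadj₁₃ λ (p₁ , _) →
        case p₀ , p₂ , p₁ of λ where
          (inj₁ a , _ , inj₁ c) → 0≢1 (trans a (≡-sym c))
          (inj₂ a , _ , inj₂ c) → 0≢1 (trans a (≡-sym c))
          (inj₁ a , inj₁ b , _) → 0≢2 (trans a (≡-sym b))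
          (inj₂ a , inj₂ b , _) → 0≢2 (trans a (≡-sym b))
          (_ , inj₁ b , inj₁ c) → 1≢2 (trans c (≡-sym b))
          (_ , inj₂ b , inj₂ c) → 1≢2 (trans c (≡-sym b))
        where
        0≢1 : f zero ≢ f (suc zero)
        0≢1 eq = case inj eq of λ ()
        0≢2 : f zero ≢ f (suc (suc zero))
        0≢2 eq = case inj eq of λ ()
        1≢2 : f (suc zero) ≢ f (suc (suc zero))
        1≢2 eq = case inj eq of λ ()
        nonadj₀₂ : ¬ CycleEdge zero (suc (suc zero))
        nonadj₀₂ (inj₁ (inj₁ ()))
        nonadj₀₂ (inj₁ (inj₂ ()))
        nonadj₀₂ (inj₂ (inj₁ ()))
        nonadj₀₂ (inj₂ (inj₂ ()))
        nonadj₁₃ : ¬ CycleEdge (suc zero) (suc (suc (suc zero)))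
        nonadj₁₃ (inj₁ (inj₁ ()))
        nonadj₁₃ (inj₁ (inj₂ ()))
        nonadj₁₃ (inj₂ (inj₁ ()))
        nonadj₁₃ (inj₂ (inj₂ ()))
        opposite : ∀ {i j} → i ≢ j → ¬ CycleEdge i j →
          ¬ ¬ ((f i ≡ u ⊎ f i ≡ v) × (f j ≡ u ⊎ f j ≡ v))
        opposite {i} {j} i≢j ¬e k = ¬e (Equivalence.to (edges i j i≢j)
          (H′⇐ (proj₁ max-clique _ _ (all i) (all j) (i≢j ∘ inj))
            (kept-in-Ω (all i) (all j) (λ (p , q) → k (inj₁ p , inj₂ q)) (λ (p , q) → k (inj₂ p , inj₁ q)))))

      -- No component sees both `u` and `v`, so `S` is still a clique in `H′` and the cycle stays in
      -- `C` and `S`. There `H` and `H′` agree, and the cycle would be a hole of `H`.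
      outside-Ω : ∀ {k} (f : Fin (suc k) → V) → 4 ≤ suc k → IsCycle H′ f → ¬ Out (f zero)
      outside-Ω f 4≤k cyc@(inj , edges) od =
        ¬¬-Π (cycle-separator C S f cyc leave clique ε) λ all →
        proj₂ (proj₁ minimal-completion) _ 4≤k
          (f , inj , λ i j i≢j → mk⇔
            (λ h → Equivalence.to (edges i j i≢j) (H′⇐ h (kept (all i) (all j))))
            (proj₁ ∘ H′⇒ ∘ Equivalence.from (edges i j i≢j)))
        where
        C S : V → Set
        C = Joined Out (f zero)
        S x = x ∈ Ω × Link (f zero) x
        not-both : ∀ {x y} → S x → S y → ¬ (x ≡ u × y ≡ v)
        not-both (_ , l) (_ , l′) (refl , refl) = none (f zero , od , l , l′)
        kept-S : ∀ {x y} → S x → S y → Kept x y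
        kept-S sx sy = kept-in-Ω (proj₁ sx) (proj₁ sy) (not-both sx sy) (λ (p , q) → not-both sy sx (q , p))
        kept-CS : ∀ {x y} → C x → S y → Kept x y
        kept-CS cx (y∈ , l) = (λ x∈ → contradiction x∈ (joined-end od cx)) , (λ _ oy → contradiction y∈ oy) ,
          (λ _ _ → link-move cx l) , λ x∈ → contradiction x∈ (joined-end od cx)
        kept : ∀ {x y} → C x ⊎ S x → C y ⊎ S y → Kept x y
        kept (inj₁ cx) (inj₁ cy) = (λ x∈ → contradiction x∈ (joined-end od cx)) , (λ _ _ → joined-sym cx ◅◅ cy) ,
          (λ _ y∈ → contradiction y∈ (joined-end od cy)) , λ x∈ → contradiction x∈ (joined-end od cx)
        kept (inj₁ cx) (inj₂ sy) = kept-CS cx sy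
        kept (inj₂ sx) (inj₁ cy) = kept-sym (kept-CS cy sx)
        kept (inj₂ sx) (inj₂ sy) = kept-S sx sy
        leave : ∀ {x y} → C x → H′ x y ≡ true → ¬ C y → S y
        leave {x} {y} cx h ¬cy with y ∈? Ω | H′⇒ h
        ... | yes y∈ | _ , (_ , _ , l , _) = y∈ , link-move (joined-sym cx) (l (joined-end od cx) y∈)
        ... | no oy | _ , (_ , j , _) = contradiction (cx ◅◅ j (joined-end od cx) oy) ¬cy
        clique : ∀ {x y} → S x → S y → x ≢ y → H′ x y ≡ true
        clique sx sy x≢y = H′⇐ (proj₁ max-clique _ _ (proj₁ sx) (proj₁ sy) x≢y) (kept-S sx sy)

      F′-chordal : Chordal H′
      F′-chordal (suc k) 4≤k (f , cyc) = inside-Ω f 4≤k cyc λ i →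
        decidable-stable (f i ∈? Ω) λ oi →
          let g , cyc′ , eq = cycle-from {A = H′} i f cyc
          in outside-Ω g 4≤k cyc′ (subst Out (≡-sym eq) oi)

      -- `F′` is a chordal completion within `F`, so minimality of `F` puts the deleted edge back.
      F′uv : F′ u v ≡ true
      F′uv = proj₂ minimal-completion F′ (F′-nonedge , F′-chordal) (λ x y → proj₁ ∘ F′⇒ x y) u v Fuv

-- Covering Ω by means of these two properties.

module Cover {n : ℕ} (G : Graph n) (Ω : Subset n) (P7-free : PFree 7 G)
  (not-full : ∀ {d} → d ∉ Ω → ¬ (∀ u → u ∈ Ω → Components.Link G Ω d u))
  (linked : ∀ {u v} → u ∈ Ω → v ∈ Ω → u ≢ v → ¬ adj G u v ≡ true →
    ¬ ¬ ∃ λ d → d ∉ Ω × Components.Link G Ω d u × Components.Link G Ω d v) where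
  open Neighbourhoods G
  open Components G Ω
  open SevenFree G P7-free

  -- For a `Closed` predicate this consists of `u` and whole components seen by `u`, so `u` is a hub
  -- that makes it connected.
  Cluster : V → (V → Set) → V → Set
  Cluster u P x = x ≡ u ⊎ (Out x × Link x u × P x)

  Closed : (V → Set) → Set
  Closed P = ∀ {x y} → Joined Out x y → P x → P y

  unlinked-closed : ∀ v → Closed (λ x → ¬ Link x v)
  unlinked-closed v xy ¬l l = ¬l (link-move (joined-sym xy) l)

  cluster-connected : ∀ {u P} → u ∈ Ω → Closed P → Connected (Cluster u P)
  cluster-connected {u} {P} u∈ closed ax ay = to-hub ax ◅◅ joined-sym (to-hub ay)
    where
    along : ∀ {x y} → Out x → Link x u → P x → Joined Out x y → Joined (Cluster u P) x y
    along _ _ _ ε = ε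
    along ox l p (s@(_ , oy , e) ◅ ss) =
      (inj₂ (ox , l , p) , inj₂ (oy , l′ , p′) , e) ◅ along oy l′ p′ ss
      where
      l′ = link-move (s ◅ ε) l
      p′ = closed (s ◅ ε) p
    to-hub : ∀ {x} → Cluster u P x → Joined (Cluster u P) x u
    to-hub (inj₁ refl) = ε
    to-hub (inj₂ (ox , l@(e , xe , oe , eu) , p)) =
      along ox l p xe ◅◅ (inj₂ (oe , link-move xe l , closed xe p) , inj₁ refl , eu) ◅ ε

  cluster-nb : ∀ {u P d y} → Closed P → Link d u → P d → Link d y → ∃ (Nb (Cluster u P) y)
  cluster-nb closed l p (e , de , oe , ey) = e , inj₂ (oe , link-move de l , closed de p) , ~-sym ey

  clusters-anticomplete : ∀ {u v} → ¬ u ~ v →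
    Anticomplete (Cluster u (λ d → ¬ Link d v)) (Cluster v (λ d → ¬ Link d u))
  clusters-anticomplete uv (inj₁ refl) (inj₁ refl) e = uv e
  clusters-anticomplete uv (inj₁ refl) (inj₂ (oy , _ , ¬l)) e = ¬l (link-edge oy (~-sym e))
  clusters-anticomplete uv (inj₂ (ox , _ , ¬l)) (inj₁ refl) e = ¬l (link-edge ox e)
  clusters-anticomplete uv (inj₂ (ox , l , _)) (inj₂ (oy , _ , ¬l)) e = ¬l (link-move ((ox , oy , e) ◅ ε) l)

  -- By `not-full` some `w` in Ω is not linked to `d`. The second connected set is `w` with all
  -- components it sees, and the component of `d` is not one of them; by `linked`, each `y` linked
  -- to `d` sees `w` or one of these components.
  component-cover : ∀ {d} → Out d → ¬ ¬ Cov 30 (λ y → y ∈ Ω × Link d y)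
  component-cover {d} od = do
    w , w∈ , ¬dw ← λ k → ¬¬-Π (λ u ¬l → ¬l λ u∈ → contradiction (u , u∈ , λ l → ¬l λ _ → l) k) (not-full od)
    let B = Cluster w (λ _ → ⊤)
        anti : Anticomplete (Joined Out d) B
        anti = λ where
          dx (inj₁ refl) e → ¬dw (link-move (joined-sym dx) (link-edge (joined-end od dx) e))
          dx (inj₂ (oy , l , _)) e → ¬dw (link-move (joined-sym (dx ◅◅ (joined-end od dx , oy , e) ◅ ε)) l)
        sees : ∀ y → y ∈ Ω × Link d y → ¬ ¬ ∃ (Nb B y)
        sees = λ y (y∈ , dy) → case adj G y w ≟ᵇ true of λ where
          (yes e) → return (w , inj₁ refl , e)
          (no ¬e) → linked y∈ w∈ (λ { refl → ¬dw dy }) ¬e >>= λ (x , _ , xy , xw) →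
            return (cluster-nb (λ _ → id) xw tt xy)
    c ← separator-cover (λ y → ∃ (Nb (Joined Out d) y) × ∃ (Nb B y)) (d , ε) (w , inj₁ refl)
          component-connected (cluster-connected w∈ λ _ → id) anti λ _ → id
    return (cov-weaken (λ y p → sees y p >>= λ b → return (component-nb (proj₂ p) , b)) c)
    where
    component-nb : ∀ {y} → Link d y → ∃ (Nb (Joined Out d) y)
    component-nb (e , de , _ , ey) = e , de , ~-sym ey

  Common : V × V → V → Set
  Common (u , v) d = Out d × Link d u × Link d v

  -- Choose the non-adjacent pair u, v with the fewest components linked to both.  A vertex y of Ω
  -- without a component linked to u and y but not v has Common (u , y) ⊑ Common (u , v), hence
  -- Common (u , v) ⊑ Common (u , y), so that every component linked to u and v is linked to y.
  nonclique-cover : (∃ λ ((u , v) : V × V) → u ∈ Ω × v ∈ Ω × u ≢ v × ¬ u ~ v) → ¬ ¬ Cov 62 (_∈ Ω)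
  nonclique-cover e = do
    (u , v) , (u∈ , v∈ , u≢v , uv) , uv-min ← minimal (pairs (fins n)) Common _ e
    d , d-common@(od , du , dv) ← linked u∈ v∈ u≢v uv
    Link? ← ¬¬-Π λ x → ¬¬-Π λ y → em (Link x y)
    let A = Cluster u (λ x → ¬ Link x v)
        B = Cluster v (λ x → ¬ Link x u)
        S = λ y → ∃ (Nb A y) × ∃ (Nb B y)
    c₁ ← separator-cover S (u , inj₁ refl) (v , inj₁ refl)
           (cluster-connected u∈ (unlinked-closed v)) (cluster-connected v∈ (unlinked-closed u))
           (clusters-anticomplete uv) λ _ → id
    c₂ ← component-cover od
    let split : ∀ y → y ∈ Ω × Far (u ∷ v ∷ []) y → ¬ ¬ (S y ⊎ (y ∈ Ω × Link d y))
        -- `u` and `v` are far from themselves and from each other; the cover for the component of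
        -- `d`, which both see, takes care of them.
        split = λ { y (y∈ , uy ∷ vy ∷ []) → case u ≟ᶠ y of λ where
          (yes refl) → return (inj₂ (y∈ , du))
          (no u≢y) → case v ≟ᶠ y of λ where
            (yes refl) → return (inj₂ (y∈ , dv))
            (no v≢y) → em (∃ (Nb A y)) >>= λ where
              (no ¬a) → return (inj₂ (y∈ , proj₂ (proj₂
                (uv-min (u , y) (u∈ , y∈ , u≢y , uy)
                  (λ x (ox , xu , xy) → ox , xu , decidable-stable (Link? x v)
                    λ ¬xv → ¬a (cluster-nb (unlinked-closed v) xu ¬xv xy))
                  d d-common))))
              (yes a) → em (∃ (Nb B y)) >>= λ where
                (no ¬b) → return (inj₂ (y∈ , proj₂ (proj₂
                  (uv-min (v , y) (v∈ , y∈ , v≢y , vy)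
                    (λ x (ox , xv , xy) → ox , decidable-stable (Link? x u)
                      (λ ¬xu → ¬b (cluster-nb (unlinked-closed u) xv ¬xu xy)) , xv)
                    d d-common))))
                (yes b) → return (inj₁ (a , b)) }
    -- The bound is 2 + (30 + 30), one `separator-cover` for each kind of vertex.
    return (cov-rest (u ∷ v ∷ []) (cov-⊎ split c₁ c₂))

-- From lists to subsets, and the conclusion.

∣p∪q∣≤∣p∣+∣q∣ : ∀ {n} (p q : Subset n) → ∣ p ∪ q ∣ ≤ ∣ p ∣ + ∣ q ∣
∣p∪q∣≤∣p∣+∣q∣ []ᵛ []ᵛ = z≤n
∣p∪q∣≤∣p∣+∣q∣ (true ∷ᵛ p) (true ∷ᵛ q) =
  s≤s (≤-trans (∣p∪q∣≤∣p∣+∣q∣ p q) (+-monoʳ-≤ ∣ p ∣ (n≤1+n ∣ q ∣)))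
∣p∪q∣≤∣p∣+∣q∣ (true ∷ᵛ p) (false ∷ᵛ q) = s≤s (∣p∪q∣≤∣p∣+∣q∣ p q)
∣p∪q∣≤∣p∣+∣q∣ (false ∷ᵛ p) (true ∷ᵛ q) =
  ≤-trans (s≤s (∣p∪q∣≤∣p∣+∣q∣ p q)) (≤-reflexive (≡-sym (+-suc ∣ p ∣ ∣ q ∣)))
∣p∪q∣≤∣p∣+∣q∣ (false ∷ᵛ p) (false ∷ᵛ q) = ∣p∪q∣≤∣p∣+∣q∣ p q

fromList : ∀ {n} → List (Fin n) → Subset n
fromList xs = ⋃ (mapᴸ ⁅_⁆ xs)

∣fromList∣≤length : ∀ {n} (xs : List (Fin n)) → ∣ fromList xs ∣ ≤ length xs
∣fromList∣≤length {n} [] = ≤-reflexive (∣⊥∣≡0 n)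
∣fromList∣≤length (x ∷ xs) = ≤-trans (∣p∪q∣≤∣p∣+∣q∣ ⁅ x ⁆ (fromList xs))
  (+-mono-≤ (≤-reflexive (∣⁅x⁆∣≡1 x)) (∣fromList∣≤length xs))

∈-fromList : ∀ {n} {x : Fin n} xs → x ∈ˡ xs → x ∈ fromList xs
∈-fromList (x ∷ xs) (here refl) = x∈p∪q⁺ (inj₁ (x∈⁅x⁆ x))
∈-fromList (_ ∷ xs) (there x∈) = x∈p∪q⁺ (inj₂ (∈-fromList xs x∈))

theorem1p4 : (n : ℕ) (G : Graph n) (Ω : Subset n) →
    PFree 7 G → PotentialMaximalClique G Ω →
    ∃[ Ω' ] (∣ Ω' ∣ ≤ 68 × (∀ v → v ∈ Ω → InClosedNbhd G Ω' v))
theorem1p4 n G Ω P7-free (F , completion , max-clique) = decidable-stable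
  -- A search through all subsets decides the conclusion, which discharges the double negation.
  (anySubset? λ Ω′ → ∣ Ω′ ∣ ≤? 68 ×-dec all? λ v → v ∈? Ω →-dec
    (v ∈? Ω′ ⊎-dec anyᶠ? λ u → u ∈? Ω′ ×-dec adj G u v ≟ᵇ true)) do
  d ← em (∃ λ ((u , v) : V × V) → u ∈ Ω × v ∈ Ω × u ≢ v × ¬ u ~ v)
  case d of λ where
    (yes e) → do
      xs , len , near ← nonclique-cover e
      return (fromList xs , ≤-trans (∣fromList∣≤length xs) (≤-trans len (m≤m+n 62 6)) , λ v v∈ →
        let x , x∈ , xv = find (near v v∈) in inj₂ (x , ∈-fromList xs x∈ , xv))
    -- If Ω is a clique of `G`, any single vertex of it dominates the rest.
    (no clique) → em (∃ (_∈ Ω)) >>= λ where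
      (no empty) → return (fromList [] , ≤-trans (∣fromList∣≤length {n} []) z≤n , λ v v∈ → contradiction (v , v∈) empty)
      (yes (w , w∈)) → return (fromList (w ∷ []) , ≤-trans (∣fromList∣≤length (w ∷ [])) (s≤s z≤n) , λ v v∈ →
        case w ≟ᶠ v of λ where
          (yes refl) → inj₁ (∈-fromList (w ∷ []) (here refl))
          (no w≢v) → inj₂ (w , ∈-fromList (w ∷ []) (here refl) ,
            ~-stable λ wv → clique ((w , v) , w∈ , v∈ , w≢v , wv)))
  where
  open Neighbourhoods G
  open Completion G Ω F completion max-clique
  open Cover G Ω P7-free not-full linked
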